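{- Let $G$ be a graph and let $F:V(G)\to 2^{\mathbb N}$. If $G$ has an orientation $D$ such that \[|F(v)|\le \tfrac{2}{3}\deg^+_D(v)-1\] for each $v\in V(G)$, then $G$ has an $F$-avoiding orientation.
   Context: For an orientation $D$ of $G$, $\deg^+_D(v)$ denotes the out-degree of $v$ in $D$. Given $F:V(G)\to 2^{\mathbb N}$ (a set of forbidden values at each vertex), an orientation $D'$ of $G$ is $F$-avoiding if $\deg^+_{D'}(v)\notin F(v)$ for every $v\in V(G)$. -}

module Defs where

open import Data.Nat using (ℕ; zero; suc; _+_; _*_; _≤_)
open import Data.Fin using (Fin)
open import Data.Bool using (Bool; true; false; if_then_else_)
open import Data.List using (List; length)
open import Data.List.Relation.Unary.Unique.Propositional using (Unique)
open import Data.List.Membership.Propositional using (_∈_)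
open import Relation.Binary.PropositionalEquality using (_≡_; _≢_)
open import Relation.Nullary using (¬_)

count : ∀ {n} → (Fin n → Bool) → ℕ
count {zero} p = 0
count {suc n} p = (if p Fin.zero then 1 else 0) + count {n} (λ i → p (Fin.suc i))


record Graph (n : ℕ) : Set where
  field
    adj     : Fin n → Fin n → Bool
    adj-sym : ∀ u v → adj u v ≡ adj v u
    adj-irr : ∀ v → adj v v ≡ false
open Graph public

record Orientation {n : ℕ} (G : Graph n) : Set where
  field
    arc       : Fin n → Fin n → Bool
    arc⊆adj   : ∀ u v → arc u v ≡ true → adj G u v ≡ true
    one-dir   : ∀ u v → adj G u v ≡ true → arc u v ≢ arc v u
open Orientation public

outdeg : ∀ {n} {G : Graph n} → Orientation G → Fin n → ℕ
outdeg D u = count (arc D u)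

-- F(v) is a finite set of naturals, represented by a duplicate-free list;
-- its cardinality is the length of the list.
FSets : ℕ → Set
FSets n = Fin n → List ℕ

WellFormedF : ∀ {n} → FSets n → Set
WellFormedF {n} F = ∀ (v : Fin n) → Unique (F v)

Avoiding : ∀ {n} {G : Graph n} → FSets n → Orientation G → Set
Avoiding {n} F D = ∀ (v : Fin n) → ¬ (outdeg D v ∈ F v)

-- |F(v)| ≤ (2/3) deg⁺_D(v) − 1, cleared of denominators: 3|F(v)| + 3 ≤ 2 deg⁺_D(v).
Bounded : ∀ {n} {G : Graph n} → FSets n → Orientation G → Set
Bounded {n} F D = ∀ (v : Fin n) → 3 * length (F v) + 3 ≤ 2 * outdeg D v

-- By the Combinatorial Nullstellensatz it suffices to find a set S of edges such that the monomial
-- ∏ x_v ^ h v, with h v ≥ |F v|, has nonzero coefficient in ∏ (x_u - x_v), the product over S.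
-- Peel the vertices off one at a time.  A vertex w with N remaining neighbours can take exponent f
-- for itself and give one extra exponent to each of k chosen neighbours whenever f + 2k ≤ N: the
-- possible choices of w's edges for S span all functionals on k-sets of neighbours.
-- Remove at each step a vertex w whose in-degree in D does not exceed its out-degree among the
-- remaining vertices, and let it serve all its remaining in-neighbours except those in T, where T
-- takes about a third of the arcs at every tail and at every head.  Then each v collects about
-- 2/3 of its out-degree; the roundings together cost no more than the −1 of the hypothesis.

module Submission where

open import Defs
open import Algebra.Properties.CommutativeMonoid.Sum as BigOp using ()
open import Data.Bool.Base using (Bool; true; false; if_then_else_; _∧_; _∨_; not)
import Data.Bool.Properties as Boolₚ
open import Data.Fin.Base using (Fin; zero; suc; punchIn)
open import Data.Fin.Permutation as Perm
  using (Permutation; _⟨$⟩ʳ_; _⟨$⟩ˡ_; insert; insert-punchIn; inverseʳ; flip)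
open import Data.Fin.Properties using (_≟_; any?)
open import Data.Fin.Subset using (Subset; _∪_; _∩_)
open import Data.Fin.Subset.Properties using (anySubset?)
open import Data.Integer.Base as ℤ using (ℤ)
import Data.Integer.Properties as ℤₚ
open import Data.List.Base using (List; []; _∷_; _++_; map; length; replicate; foldl; allFin)
open import Data.List.Membership.Propositional using (_∈_; _∉_)
open import Data.List.Membership.Propositional.Properties using (∈-allFin; ∈-++⁺ˡ)
open import Data.List.Properties using (length-map; length-++; length-replicate; map-∘; map-id)
open import Data.List.Relation.Binary.Sublist.Propositional
  using (_⊆_; []; _∷_; _∷ʳ_; minimum; ⊆-refl; ⊆-trans)
open import Data.List.Relation.Binary.Sublist.Propositional.Properties using (map⁺; ++⁺)
open import Data.List.Relation.Unary.Any using (here; there)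
open import Data.Nat.Base as ℕ using (ℕ; zero; suc)
open import Data.Nat.DivMod using (_/_; _%_; m≡m%n+[m/n]*n; m%n<n)
import Data.Nat.Properties as ℕₚ
import Data.Nat.Tactic.RingSolver as ℕ-Ring
open import Data.Product using (∃; ∃₂; _×_; _,_)
open import Data.Sum using (_⊎_; inj₁; inj₂)
open import Data.Vec.Base using (lookup; tabulate)
import Data.Vec.Functional as F
open import Data.Vec.Properties using (lookup∘tabulate; lookup-zipWith)
open import Function using (_∘_; id)
open import Relation.Binary.PropositionalEquality
open import Relation.Nullary using (Dec; yes; no; does; contradiction; _×-dec_; ¬?)

-- Let ib and ob count the arcs between w and the remaining vertices, into w and out of it. Serving
-- all but τ of the ib in-neighbours costs 2(ib - τ) of the ib + ob edges, so w keeps ob - ib + 2τ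
-- for itself, and ib ≤ ob makes this nonnegative whatever T is. An arc in T therefore gives two
-- exponents to its head and takes one from its tail; a share of 2/3 on both sides asks for exactly
-- a third of the arcs at each end. The obstacle is rounding. Measured in thirds, the -1 of the
-- hypothesis and integrality together leave room for an error of 5 at each vertex. An in-degree
-- that is 2 mod 3, rounded down, costs 4; an out-degree that is 1 mod 3, rounded up, costs 2; both
-- at one vertex cost 6. An auxiliary loop, to be taken or not, rules out this coincidence and keeps
-- the error at 4 or less. T exists because weight 1/3 on every arc solves a bipartite degree
-- problem fractionally; the cut condition turns this into an integral solution.

private
  module ∑ℕ = BigOp ℕₚ.+-0-commutativeMonoid
  module ∑ℤ = BigOp ℤₚ.+-0-commutativeMonoid
  module ∏ℤ = BigOp ℤₚ.*-1-commutativeMonoid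

open ∑ℕ using (sum; sum-cong-≗; sum-replicate-zero; ∑-distrib-+; ∑-comm; sum-remove; sum-permute)

module _ where
  open import Data.Integer.Base using (+_; -[1+_]; 0ℤ; 1ℤ; _+_; _-_; _*_; -_)
  open import Data.Integer.Tactic.RingSolver using (solve-∀)

  -- Sums over the `k`-sublists of a list

  private variable
    V : Set

  ∑⊆ : ℕ → List V → (List V → ℤ) → ℤ
  ∑⊆ zero    _       φ = φ []
  ∑⊆ (suc k) []      φ = 0ℤ
  ∑⊆ (suc k) (a ∷ S) φ = ∑⊆ k S (φ ∘ (a ∷_)) + ∑⊆ (suc k) S φ

  ∑⊆-cong : ∀ k (S : List V) {φ ψ} → (∀ R → φ R ≡ ψ R) → ∑⊆ k S φ ≡ ∑⊆ k S ψ
  ∑⊆-cong zero    S       eq = eq []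
  ∑⊆-cong (suc k) []      eq = refl
  ∑⊆-cong (suc k) (a ∷ S) eq = cong₂ _+_ (∑⊆-cong k S (eq ∘ (a ∷_))) (∑⊆-cong (suc k) S eq)

  ∑⊆-neg : ∀ k (S : List V) φ → ∑⊆ k S (-_ ∘ φ) ≡ - ∑⊆ k S φ
  ∑⊆-neg zero    S       φ = refl
  ∑⊆-neg (suc k) []      φ = refl
  ∑⊆-neg (suc k) (a ∷ S) φ =
    trans (cong₂ _+_ (∑⊆-neg k S (φ ∘ (a ∷_))) (∑⊆-neg (suc k) S φ))
          (sym (ℤₚ.neg-distrib-+ (∑⊆ k S (φ ∘ (a ∷_))) (∑⊆ (suc k) S φ)))

  ∑⊆-zero : ∀ k (S : List V) φ → (∀ R → R ⊆ S → length R ≡ k → φ R ≡ 0ℤ) → ∑⊆ k S φ ≡ 0ℤ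
  ∑⊆-zero zero    S       φ φ≡0 = φ≡0 [] (minimum S) refl
  ∑⊆-zero (suc k) []      φ φ≡0 = refl
  ∑⊆-zero (suc k) (a ∷ S) φ φ≡0 =
    cong₂ _+_ (∑⊆-zero k S (φ ∘ (a ∷_)) (λ R R⊆S eq → φ≡0 (a ∷ R) (refl ∷ R⊆S) (cong suc eq)))
              (∑⊆-zero (suc k) S φ (λ R R⊆S → φ≡0 R (a ∷ʳ R⊆S)))

  ∑⊆-short : ∀ k (S : List V) φ → length S ℕ.< k → ∑⊆ k S φ ≡ 0ℤ
  ∑⊆-short (suc k) []      φ _           = refl
  ∑⊆-short (suc k) (a ∷ S) φ (ℕ.s≤s lt) =
    cong₂ _+_ (∑⊆-short k S (φ ∘ (a ∷_)) lt) (∑⊆-short (suc k) S φ (ℕₚ.m<n⇒m<1+n lt))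

  ∑⊆-full : ∀ (S : List V) φ → ∑⊆ (length S) S φ ≡ φ S
  ∑⊆-full []      φ = refl
  ∑⊆-full (a ∷ S) φ =
    trans (cong₂ _+_ (∑⊆-full S (φ ∘ (a ∷_))) (∑⊆-short (suc (length S)) S φ ℕₚ.≤-refl))
          (ℤₚ.+-identityʳ (φ (a ∷ S)))

  ∑-del : List V → (List V → ℤ) → ℤ
  ∑-del []      ω = 0ℤ
  ∑-del (s ∷ S) ω = ω S + ∑-del S (ω ∘ (s ∷_))

  ∑-del-+ : ∀ (S : List V) ω η → ∑-del S (λ X → ω X + η X) ≡ ∑-del S ω + ∑-del S η
  ∑-del-+ []      ω η = refl
  ∑-del-+ (s ∷ S) ω η =
    trans (cong (_+_ (ω S + η S)) (∑-del-+ S (ω ∘ (s ∷_)) (η ∘ (s ∷_))))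
          (lemma (ω S) (η S) (∑-del S (ω ∘ (s ∷_))) (∑-del S (η ∘ (s ∷_))))
    where
    lemma : ∀ a b c d → a + b + (c + d) ≡ a + c + (b + d)
    lemma = solve-∀

  ∑-del-zero : ∀ (S : List V) ω → (∀ X → X ⊆ S → suc (length X) ≡ length S → ω X ≡ 0ℤ) →
               ∑-del S ω ≡ 0ℤ
  ∑-del-zero []      ω ω≡0 = refl
  ∑-del-zero (s ∷ S) ω ω≡0 =
    cong₂ _+_ (ω≡0 S (s ∷ʳ ⊆-refl) refl)
              (∑-del-zero S (ω ∘ (s ∷_)) (λ X X⊆S eq → ω≡0 (s ∷ X) (refl ∷ X⊆S) (cong suc eq)))

  -- Each k-sublist of S survives the deletion of length S - k of the entries of S.
  ∑-del-∑⊆ : ∀ k (S : List V) φ → ∑-del S (λ X → ∑⊆ k X φ) ≡ (+ length S - + k) * ∑⊆ k S φ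
  ∑-del-∑⊆ zero    []      φ = sym (ℤₚ.*-zeroˡ (φ []))
  ∑-del-∑⊆ zero    (s ∷ S) φ =
    trans (cong (_+_ (φ [])) (∑-del-∑⊆ zero S φ)) (lemma (φ []) (+ length S))
    where
    lemma : ∀ x l → x + (l - 0ℤ) * x ≡ (1ℤ + l - 0ℤ) * x
    lemma = solve-∀
  ∑-del-∑⊆ (suc k) []      φ = sym (ℤₚ.*-zeroʳ (0ℤ - + suc k))
  ∑-del-∑⊆ (suc k) (s ∷ S) φ = begin
    ∑⊆ (suc k) S φ + ∑-del S (λ X → ∑⊆ k X φₛ + ∑⊆ (suc k) X φ)
      ≡⟨ cong (_+_ (∑⊆ (suc k) S φ)) (∑-del-+ S (λ X → ∑⊆ k X φₛ) (λ X → ∑⊆ (suc k) X φ)) ⟩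
    ∑⊆ (suc k) S φ + (∑-del S (λ X → ∑⊆ k X φₛ) + ∑-del S (λ X → ∑⊆ (suc k) X φ))
      ≡⟨ cong (_+_ (∑⊆ (suc k) S φ)) (cong₂ _+_ (∑-del-∑⊆ k S φₛ) (∑-del-∑⊆ (suc k) S φ)) ⟩
    ∑⊆ (suc k) S φ + ((+ length S - + k) * ∑⊆ k S φₛ + (+ length S - + suc k) * ∑⊆ (suc k) S φ)
      ≡⟨ lemma (∑⊆ (suc k) S φ) (∑⊆ k S φₛ) (+ length S) (+ k) ⟩
    (+ suc (length S) - + suc k) * (∑⊆ k S φₛ + ∑⊆ (suc k) S φ) ∎
    where
    open ≡-Reasoning
    φₛ = φ ∘ (s ∷_)
    lemma : ∀ x y l k → x + ((l - k) * y + (l - (1ℤ + k)) * x) ≡ (1ℤ + l - (1ℤ + k)) * (y + x)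
    lemma = solve-∀

  -- Inclusion of k-sets in (k + f)-sets has full rank once 2k + f ≤ |A| (Gottlieb). Split φ by
  -- whether R contains the head a: averaging over deletions makes the part with a satisfy the
  -- hypothesis for (k - 1 , f + 1), and what remains satisfies it for (k , f - 1).
  ∑⊆-vanish : ∀ (A : List V) k f φ → k ℕ.+ k ℕ.+ f ℕ.≤ length A →
             (∀ S → S ⊆ A → length S ≡ k ℕ.+ f → ∑⊆ k S φ ≡ 0ℤ) →
             ∀ R → R ⊆ A → length R ≡ k → φ R ≡ 0ℤ
  ∑⊆-vanish A k zero φ _ ∑≡0 R R⊆A refl =
    trans (sym (∑⊆-full R φ)) (∑≡0 R R⊆A (sym (ℕₚ.+-identityʳ k)))
  ∑⊆-vanish [] zero (suc f) φ () ∑≡0 R R⊆A eq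
  ∑⊆-vanish [] (suc k) (suc f) φ () ∑≡0 R R⊆A eq
  ∑⊆-vanish (a ∷ A) zero (suc f) φ (ℕ.s≤s le) ∑≡0 [] R⊆A eq =
    ∑⊆-vanish A zero f φ le
      (λ S S⊆A eq′ → ∑≡0 (a ∷ S) (refl ∷ S⊆A) (cong suc eq′)) [] (minimum A) refl
  ∑⊆-vanish (a ∷ A) (suc k) (suc f) φ le ∑≡0 = split
    where
    φₐ = φ ∘ (a ∷_)

    ∑ₐ≡0 : ∀ S → S ⊆ A → length S ≡ k ℕ.+ suc (suc f) → ∑⊆ k S φₐ ≡ 0ℤ
    -- Sum the hypothesis over all `a ∷ X` with `X` one entry short of `S`. The terms without `a`
    -- cancel by the hypothesis for `S` itself, which leaves the wanted sum times `length S - k`, a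
    -- nonzero factor.
    ∑ₐ≡0 S S⊆A eq with ℤₚ.i*j≡0⇒i≡0∨j≡0 (+ length S - + k) prod≡0
      where
      open ≡-Reasoning
      len : length S ≡ suc k ℕ.+ suc f
      len = trans eq (ℕₚ.+-suc k (suc f))
      prod≡0 : (+ length S - + k) * ∑⊆ k S φₐ ≡ 0ℤ
      prod≡0 = begin
        (+ length S - + k) * ∑⊆ k S φₐ
          ≡⟨ sym (ℤₚ.+-identityʳ _) ⟩
        (+ length S - + k) * ∑⊆ k S φₐ + 0ℤ
          ≡⟨ cong₂ _+_ (sym (∑-del-∑⊆ k S φₐ))
               (sym (trans (∑-del-∑⊆ (suc k) S φ)
                      (trans (cong ((+ length S - + suc k) *_) (∑≡0 S (a ∷ʳ S⊆A) len))
                             (ℤₚ.*-zeroʳ (+ length S - + suc k))))) ⟩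
        ∑-del S (λ X → ∑⊆ k X φₐ) + ∑-del S (λ X → ∑⊆ (suc k) X φ)
          ≡⟨ sym (∑-del-+ S (λ X → ∑⊆ k X φₐ) (λ X → ∑⊆ (suc k) X φ)) ⟩
        ∑-del S (λ X → ∑⊆ (suc k) (a ∷ X) φ)
          ≡⟨ ∑-del-zero S _ (λ X X⊆S eq′ →
               ∑≡0 (a ∷ X) (refl ∷ ⊆-trans X⊆S S⊆A) (trans eq′ len)) ⟩
        0ℤ ∎
    ... | inj₂ w≡0 = w≡0
    ... | inj₁ l-k≡0 = contradiction
            (trans (sym eq) (ℤₚ.+-injective (ℤₚ.i-j≡0⇒i≡j (+ length S) (+ k) l-k≡0)))
            (λ e → ℕₚ.m+1+n≢m k e)

    le₁ : k ℕ.+ k ℕ.+ suc (suc f) ℕ.≤ length A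
    le₁ = ℕₚ.≤-trans (ℕₚ.≤-reflexive (lemma k f)) (ℕ.s≤s⁻¹ le)
      where
      lemma : ∀ k f → k ℕ.+ k ℕ.+ (2 ℕ.+ f) ≡ k ℕ.+ (1 ℕ.+ k) ℕ.+ (1 ℕ.+ f)
      lemma = ℕ-Ring.solve-∀

    le₂ : suc k ℕ.+ suc k ℕ.+ f ℕ.≤ length A
    le₂ = ℕₚ.≤-trans (ℕₚ.≤-reflexive (sym (ℕₚ.+-suc (k ℕ.+ suc k) f))) (ℕ.s≤s⁻¹ le)

    φₐ≡0 : ∀ R → R ⊆ A → length R ≡ k → φₐ R ≡ 0ℤ
    φₐ≡0 = ∑⊆-vanish A k (suc (suc f)) φₐ le₁ ∑ₐ≡0

    split : ∀ R → R ⊆ a ∷ A → length R ≡ suc k → φ R ≡ 0ℤ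
    split (_ ∷ R) (refl ∷ R⊆A) eq = φₐ≡0 R R⊆A (ℕₚ.suc-injective eq)
    split R       (_ ∷ʳ R⊆A)   eq = ∑⊆-vanish A (suc k) f φ le₂ ∑≡0′ R R⊆A eq
      where
      ∑≡0′ : ∀ S → S ⊆ A → length S ≡ suc k ℕ.+ f → ∑⊆ (suc k) S φ ≡ 0ℤ
      ∑≡0′ S S⊆A eq′ = begin
        ∑⊆ (suc k) S φ
          ≡⟨ sym (ℤₚ.+-identityˡ _) ⟩
        0ℤ + ∑⊆ (suc k) S φ
          ≡⟨ cong (_+ ∑⊆ (suc k) S φ) (sym (∑⊆-zero k S φₐ λ R R⊆S → φₐ≡0 R (⊆-trans R⊆S S⊆A))) ⟩
        ∑⊆ (suc k) (a ∷ S) φ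
          ≡⟨ ∑≡0 (a ∷ S) (refl ∷ S⊆A) (trans (cong suc eq′) (sym (cong suc (ℕₚ.+-suc k f)))) ⟩
        0ℤ ∎
        where open ≡-Reasoning

  anySublist? : ∀ {P : List V → Set} (A : List V) → (∀ S → Dec (P S)) →
                Dec (∃ λ S → S ⊆ A × P S)
  anySublist? [] P? with P? []
  ... | yes p = yes ([] , [] , p)
  ... | no ¬p = no λ { ([] , [] , p) → ¬p p }
  anySublist? (a ∷ A) P? with anySublist? A (P? ∘ (a ∷_)) | anySublist? A P?
  ... | yes (S , S⊆A , p) | _ = yes (a ∷ S , refl ∷ S⊆A , p)
  ... | no _ | yes (S , S⊆A , p) = yes (S , a ∷ʳ S⊆A , p)
  ... | no ¬p | no ¬q = no λ
    { (_ ∷ S , refl ∷ S⊆A , p) → ¬p (S , S⊆A , p)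
    ; (S , _ ∷ʳ S⊆A , p) → ¬q (S , S⊆A , p) }

  -- Contrapositive of `∑⊆-vanish`, made constructive by searching the finitely many sublists of
  -- `A`.
  ∑⊆-nonzero : ∀ (A : List V) k f φ → k ℕ.+ k ℕ.+ f ℕ.≤ length A →
              ∀ R → R ⊆ A → length R ≡ k → φ R ≢ 0ℤ →
              ∃ λ S → S ⊆ A × length S ≡ k ℕ.+ f × ∑⊆ k S φ ≢ 0ℤ
  ∑⊆-nonzero A k f φ le R R⊆A eq φR≢0
    with anySublist? A (λ S → (length S ℕₚ.≟ k ℕ.+ f) ×-dec ¬? (∑⊆ k S φ ℤₚ.≟ 0ℤ))
  ... | yes found = found
  ... | no none = contradiction (∑⊆-vanish A k f φ le vanish R R⊆A eq) φR≢0
    where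
    vanish : ∀ S → S ⊆ A → length S ≡ k ℕ.+ f → ∑⊆ k S φ ≡ 0ℤ
    vanish S S⊆A eq′ with ∑⊆ k S φ ℤₚ.≟ 0ℤ
    ... | yes w≡0 = w≡0
    ... | no w≢0 = contradiction (S , S⊆A , eq′ , w≢0) none

  -- The graph polynomial

  ∏ : ∀ {n} → (Fin n → ℤ) → ℤ
  ∏ = ∏ℤ.sum

  ∑ : ∀ {n} → (Fin n → ℤ) → ℤ
  ∑ = ∑ℤ.sum

  Edges : ℕ → Set
  Edges n = List (Fin n × Fin n)

  δ : ∀ {n} → Fin n → Fin n → ℤ
  δ u v = if does (u ≟ v) then 1ℤ else 0ℤ

  infixl 6 _⊕_ _⊖_

  _⊕_ _⊖_ : ∀ {n} → (Fin n → ℤ) → Fin n → Fin n → ℤ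
  (z ⊕ u) v = z v + δ u v
  (z ⊖ u) v = z v - δ u v

  isZero : ℤ → ℤ
  isZero (+ 0) = 1ℤ
  isZero _     = 0ℤ

  -- The coefficient of ∏ x_v ^ f v in the graph polynomial ∏ (x_u - x_v) over the listed edges.
  -- Integer exponents spare the truncation: a negative one can never return to zero.
  coef : ∀ {n} → Edges n → (Fin n → ℤ) → ℤ
  coef []            f = ∏ (isZero ∘ f)
  coef ((u , v) ∷ S) f = coef S (f ⊖ u) - coef S (f ⊖ v)

  coef-cong : ∀ {n} (S : Edges n) {f g} → f ≗ g → coef S f ≡ coef S g
  coef-cong []            f≗g = ∏ℤ.sum-cong-≗ (cong isZero ∘ f≗g)
  coef-cong ((u , v) ∷ S) f≗g =
    cong₂ _-_ (coef-cong S (λ x → cong (_- δ u x) (f≗g x)))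
              (coef-cong S (λ x → cong (_- δ v x) (f≗g x)))

  ∑-δ : ∀ {n} (u : Fin n) → ∑ (δ u) ≡ 1ℤ
  ∑-δ {suc n} zero    = cong (_+_ 1ℤ) (∑ℤ.sum-replicate-zero n)
  ∑-δ {suc n} (suc u) = trans (ℤₚ.+-identityˡ _) (∑-δ u)

  ∑-⊖ : ∀ {n} (f : Fin n → ℤ) u → ∑ (f ⊖ u) + 1ℤ ≡ ∑ f
  ∑-⊖ f u = trans (cong (_+_ (∑ (f ⊖ u))) (sym (∑-δ u)))
           (trans (sym (∑ℤ.∑-distrib-+ (f ⊖ u) (δ u)))
                  (∑ℤ.sum-cong-≗ (λ v → lemma (f v) (δ u v))))
    where
    lemma : ∀ a b → a - b + b ≡ a
    lemma = solve-∀

  -- Homogeneity: every edge contributes a linear factor. This supplies the degree hypothesis of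
  -- `alt≡coef`.
  coef-degree : ∀ {n} (S : Edges n) f → coef S f ≢ 0ℤ → ∑ f ≡ + length S
  coef-degree [] f c≢0 = go f c≢0
    where
    go : ∀ {n} (f : Fin n → ℤ) → ∏ (isZero ∘ f) ≢ 0ℤ → ∑ f ≡ 0ℤ
    go {zero}  f c≢0 = refl
    go {suc n} f c≢0 with f zero
    ... | + 0     = trans (ℤₚ.+-identityˡ _) (go (f ∘ suc) (c≢0 ∘ trans (ℤₚ.*-identityˡ _)))
    ... | + suc k = contradiction (ℤₚ.*-zeroˡ (∏ (isZero ∘ f ∘ suc))) c≢0
    ... | -[1+ k ] = contradiction (ℤₚ.*-zeroˡ (∏ (isZero ∘ f ∘ suc))) c≢0
  coef-degree ((u , v) ∷ S) f c≢0 with coef S (f ⊖ u) ℤₚ.≟ 0ℤ | coef S (f ⊖ v) ℤₚ.≟ 0ℤ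
  ... | no cu≢0 | _ = trans (sym (∑-⊖ f u))
        (trans (cong (_+ 1ℤ) (coef-degree S (f ⊖ u) cu≢0)) (ℤₚ.+-comm (+ length S) 1ℤ))
  ... | yes _ | no cv≢0 = trans (sym (∑-⊖ f v))
        (trans (cong (_+ 1ℤ) (coef-degree S (f ⊖ v) cv≢0)) (ℤₚ.+-comm (+ length S) 1ℤ))
  ... | yes cu≡0 | yes cv≡0 = contradiction (cong₂ _-_ cu≡0 cv≡0) c≢0

  -- Finite differences and leading coefficients

  Δ : (ℤ → ℤ) → ℤ → ℤ
  Δ p x = p (x + 1ℤ) - p x

  -- Lead a p L: the a-th difference of p is the constant L; for a negative, p vanishes.
  Lead : ℤ → (ℤ → ℤ) → ℤ → Set
  Lead (+ zero)  p L = ∀ x → p x ≡ L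
  Lead (+ suc a) p L = Lead (+ a) (Δ p) L
  Lead -[1+ _ ]  p L = ∀ x → p x ≡ 0ℤ

  Lead-cong : ∀ a {p q L} → p ≗ q → Lead a p L → Lead a q L
  Lead-cong (+ zero)  p≗q l x = trans (sym (p≗q x)) (l x)
  Lead-cong (+ suc a) p≗q l   = Lead-cong (+ a) (λ x → cong₂ _-_ (p≗q (x + 1ℤ)) (p≗q x)) l
  Lead-cong -[1+ _ ]  p≗q l x = trans (sym (p≗q x)) (l x)

  Lead-Δ : ∀ a {p L} → Lead a p L → Lead (a - 1ℤ) (Δ p) L
  Lead-Δ (+ zero)  {L = L} l x = trans (cong₂ _-_ (l (x + 1ℤ)) (l x)) (ℤₚ.+-inverseʳ L)
  Lead-Δ (+ suc a) l   = l
  Lead-Δ -[1+ _ ]  l x = cong₂ _-_ (l (x + 1ℤ)) (l x)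

  Lead-shift : ∀ a {p L} → Lead (+ a) p L → Lead (+ a) (λ x → p (x + 1ℤ)) L
  Lead-shift zero    l x = l (x + 1ℤ)
  Lead-shift (suc a) l   = Lead-shift a l

  Lead-+ : ∀ a {p q K L} → Lead (+ a) p K → Lead (+ a) q L → Lead (+ a) (λ x → p x + q x) (K + L)
  Lead-+ zero    k l x = cong₂ _+_ (k x) (l x)
  Lead-+ (suc a) {p} {q} k l =
    Lead-cong (+ a) (λ x → lemma (p (x + 1ℤ)) (p x) (q (x + 1ℤ)) (q x)) (Lead-+ a k l)
    where
    lemma : ∀ a b c d → a - b + (c - d) ≡ a + c - (b + d)
    lemma = solve-∀

  -- Discrete product rule: the difference of `(x - c) * p x` is `(x - c) * Δ p x + p (x + 1ℤ)`. The
  -- shifted term adds one `L` at each level, and this is where the factorials come from.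
  Lead-factor : ∀ a {p L} c → Lead (+ a) p L → Lead (+ suc a) (λ x → (x - c) * p x) (+ suc a * L)
  Lead-factor zero    {p} {L} c l x =
    trans (cong₂ (λ s t → (x + 1ℤ - c) * s - (x - c) * t) (l (x + 1ℤ)) (l x)) (lemma x c L)
    where
    lemma : ∀ x c L → (x + 1ℤ - c) * L - (x - c) * L ≡ 1ℤ * L
    lemma = solve-∀
  Lead-factor (suc a) {p} {L} c l =
    subst (Lead (+ suc a) (Δ (λ x → (x - c) * p x))) (lemma₁ (+ suc a) L)
      (Lead-cong (+ suc a) {λ x → (x - c) * Δ p x + p (x + 1ℤ)} {Δ (λ x → (x - c) * p x)}
        (λ x → lemma₂ x c (p (x + 1ℤ)) (p x))
        (Lead-+ (suc a) {λ x → (x - c) * Δ p x} {λ x → p (x + 1ℤ)}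
          (Lead-factor a c l) (Lead-shift (suc a) {p} l)))
    where
    lemma₁ : ∀ a L → a * L + L ≡ (1ℤ + a) * L
    lemma₁ = solve-∀
    lemma₂ : ∀ x c s t → (x - c) * (s - t) + s ≡ (x + 1ℤ - c) * s - (x - c) * t
    lemma₂ = solve-∀

  roots : List ℕ → ℤ → ℤ
  roots []       x = 1ℤ
  roots (c ∷ cs) x = (x - + c) * roots cs x

  fact : ℕ → ℤ
  fact zero    = 1ℤ
  fact (suc a) = + suc a * fact a

  fact≢0 : ∀ a → fact a ≢ 0ℤ
  fact≢0 (suc a) eq with ℤₚ.i*j≡0⇒i≡0∨j≡0 (+ suc a) eq
  ... | inj₂ eq′ = fact≢0 a eq′

  Lead-roots : ∀ cs → Lead (+ length cs) (roots cs) (fact (length cs))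
  Lead-roots []       x = refl
  Lead-roots (c ∷ cs) = Lead-factor (length cs) (+ c) (Lead-roots cs)

  -- Signed sums over the directions of the edges

  eval : ∀ {n} → (Fin n → ℤ → ℤ) → (Fin n → ℤ) → ℤ
  eval p z = ∏ (λ v → p v (z v))

  Δ[_] : ∀ {n} → Fin n → (Fin n → ℤ → ℤ) → Fin n → ℤ → ℤ
  Δ[ u ] p v = if does (u ≟ v) then Δ (p v) else p v

  eval-⊕ : ∀ {n} (p : Fin n → ℤ → ℤ) z u → eval p (z ⊕ u) ≡ eval p z + eval (Δ[ u ] p) z
  eval-⊕ {suc n} p z zero = begin
    p zero (z zero + 1ℤ) * ∏ (λ v → p (suc v) (z (suc v) + 0ℤ))
      ≡⟨ cong (p zero (z zero + 1ℤ) *_)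
           (∏ℤ.sum-cong-≗ (λ v → cong (p (suc v)) (ℤₚ.+-identityʳ (z (suc v))))) ⟩
    p zero (z zero + 1ℤ) * P
      ≡⟨ lemma (p zero (z zero + 1ℤ)) (p zero (z zero)) P ⟩
    p zero (z zero) * P + Δ (p zero) (z zero) * P ∎
    where
    open ≡-Reasoning
    P = eval (p ∘ suc) (z ∘ suc)
    lemma : ∀ a b c → a * c ≡ b * c + (a - b) * c
    lemma = solve-∀
  eval-⊕ {suc n} p z (suc u) = begin
    p zero (z zero + 0ℤ) * eval (p ∘ suc) ((z ∘ suc) ⊕ u)
      ≡⟨ cong₂ _*_ (cong (p zero) (ℤₚ.+-identityʳ (z zero))) (eval-⊕ (p ∘ suc) (z ∘ suc) u) ⟩
    p zero (z zero) * (eval (p ∘ suc) (z ∘ suc) + eval (Δ[ u ] (p ∘ suc)) (z ∘ suc))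
      ≡⟨ ℤₚ.*-distribˡ-+ (p zero (z zero)) _ _ ⟩
    eval p z + eval (Δ[ suc u ] p) z ∎
    where open ≡-Reasoning

  -- Signed sum over the two directions of the edges in S; the edges of E outside S stay at u → v.
  alt : ∀ {n} {S E : Edges n} → S ⊆ E → (Fin n → ℤ → ℤ) → (Fin n → ℤ) → ℤ
  alt []                          p z = eval p z
  alt ((u , v) ∷ʳ τ)              p z = alt τ p (z ⊕ u)
  alt (_∷_ {x = u , v} _ τ)       p z = alt τ p (z ⊕ u) - alt τ p (z ⊕ v)

  alt-cong : ∀ {n} {S E : Edges n} (τ : S ⊆ E) p {y z} → y ≗ z → alt τ p y ≡ alt τ p z
  alt-cong []                    p eq = ∏ℤ.sum-cong-≗ (λ v → cong (p v) (eq v))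
  alt-cong ((u , v) ∷ʳ τ)        p eq = alt-cong τ p (λ x → cong (_+ δ u x) (eq x))
  alt-cong (_∷_ {x = u , v} _ τ) p eq =
    cong₂ _-_ (alt-cong τ p (λ x → cong (_+ δ u x) (eq x)))
              (alt-cong τ p (λ x → cong (_+ δ v x) (eq x)))

  alt-⊕ : ∀ {n} {S E : Edges n} (τ : S ⊆ E) p z w →
          alt τ p (z ⊕ w) ≡ alt τ p z + alt τ (Δ[ w ] p) z
  alt-⊕ {n} τ₀ p z w = go τ₀ z
    where
    swap : ∀ z u (x : Fin n) → (z ⊕ w ⊕ u) x ≡ (z ⊕ u ⊕ w) x
    swap z u x = lemma (z x) (δ w x) (δ u x)
      where
      lemma : ∀ a b c → a + b + c ≡ a + c + b
      lemma = solve-∀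
    go : ∀ {S E : Edges n} (τ : S ⊆ E) z → alt τ p (z ⊕ w) ≡ alt τ p z + alt τ (Δ[ w ] p) z
    go []                    z = eval-⊕ p z w
    go ((u , v) ∷ʳ τ)        z = trans (alt-cong τ p (swap z u)) (go τ (z ⊕ u))
    go (_∷_ {x = u , v} _ τ) z =
      trans (cong₂ _-_ (trans (alt-cong τ p (swap z u)) (go τ (z ⊕ u)))
                       (trans (alt-cong τ p (swap z v)) (go τ (z ⊕ v))))
            (lemma (alt τ p (z ⊕ u)) _ (alt τ p (z ⊕ v)) _)
      where
      lemma : ∀ a b c d → a + b - (c + d) ≡ a - c + (b - d)
      lemma = solve-∀

  Lead-Δ[] : ∀ {n} u {f L : Fin n → ℤ} {p : Fin n → ℤ → ℤ} →
             (∀ v → Lead (f v) (p v) (L v)) → ∀ v → Lead ((f ⊖ u) v) (Δ[ u ] p v) (L v)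
  Lead-Δ[] u {f} {L} {p} l v with does (u ≟ v)
  ... | true  = Lead-Δ (f v) (l v)
  ... | false = subst (λ a → Lead a (p v) (L v)) (sym (ℤₚ.+-identityʳ (f v))) (l v)

  -- Some exponent is negative, and the factor there is identically zero.
  eval-neg : ∀ {n} (f L : Fin n → ℤ) p z → (∀ v → Lead (f v) (p v) (L v)) → ∑ f ℤ.< 0ℤ → eval p z ≡ 0ℤ
  eval-neg {zero}  f L p z l (ℤ.+<+ ())
  eval-neg {suc n} f L p z l lt with f zero | l zero
  ... | -[1+ _ ] | l₀ = trans (cong (_* eval (p ∘ suc) (z ∘ suc)) (l₀ (z zero))) (ℤₚ.*-zeroˡ (eval (p ∘ suc) (z ∘ suc)))
  ... | + a | l₀ = trans (cong (p zero (z zero) *_) (eval-neg (f ∘ suc) (L ∘ suc) (p ∘ suc) (z ∘ suc) (l ∘ suc)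
          (ℤₚ.≤-<-trans (ℤₚ.i≤j+i (∑ (f ∘ suc)) (+ a)) lt))) (ℤₚ.*-zeroʳ (p zero (z zero)))

  -- Either all exponents are zero and every factor is its constant, or some exponent is negative
  -- and both sides vanish; a positive exponent forces a negative one elsewhere.
  eval-zero : ∀ {n} (f L : Fin n → ℤ) p z → (∀ v → Lead (f v) (p v) (L v)) → ∑ f ≡ 0ℤ →
              eval p z ≡ ∏ (isZero ∘ f) * ∏ L
  eval-zero {zero}  f L p z l eq = refl
  eval-zero {suc n} f L p z l eq with f zero | l zero
  ... | + zero | l₀ = trans
          (cong₂ _*_ (l₀ (z zero)) (eval-zero (f ∘ suc) (L ∘ suc) (p ∘ suc) (z ∘ suc) (l ∘ suc)
                                     (trans (sym (ℤₚ.+-identityˡ _)) eq)))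
          (lemma (L zero) (∏ (isZero ∘ f ∘ suc)) (∏ (L ∘ suc)))
    where
    lemma : ∀ a b c → a * (b * c) ≡ 1ℤ * b * (a * c)
    lemma = solve-∀
  ... | + suc a | l₀ = trans
          (cong (p zero (z zero) *_) (eval-neg (f ∘ suc) (L ∘ suc) (p ∘ suc) (z ∘ suc) (l ∘ suc)
            (ℤₚ.<-≤-trans (lemma₁ (∑ (f ∘ suc))) (ℤₚ.≤-reflexive eq))))
          (trans (ℤₚ.*-zeroʳ (p zero (z zero))) (lemma₂ (∏ (isZero ∘ f ∘ suc)) (∏ L)))
    where
    lemma₁ : ∀ s → s ℤ.< + suc a + s
    lemma₁ s = ℤₚ.≤-<-trans (ℤₚ.i≤j+i s (+ a))
                 (ℤₚ.+-monoˡ-< s (ℤ.+<+ (ℕₚ.n<1+n a)))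
    lemma₂ : ∀ x y → 0ℤ ≡ 0ℤ * x * y
    lemma₂ = solve-∀
  ... | -[1+ _ ] | l₀ = trans (cong (_* eval (p ∘ suc) (z ∘ suc)) (l₀ (z zero)))
          (lemma (eval (p ∘ suc) (z ∘ suc)) (∏ (isZero ∘ f ∘ suc)) (∏ L))
    where
    lemma : ∀ w x y → 0ℤ * w ≡ 0ℤ * x * y
    lemma = solve-∀

  -- Each edge contributes a difference of shifts (1 + Δ[ u ]) - (1 + Δ[ v ]) = Δ[ u ] - Δ[ v ], so
  -- the exponents left over count the differences that every factor has still to absorb.
  alt≡coef : ∀ {n} {S E : Edges n} (τ : S ⊆ E) f L p z → (∀ v → Lead (f v) (p v) (L v)) →
             ∑ f ≡ + length S → alt τ p z ≡ coef S f * ∏ L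
  alt≡coef [] f L p z l eq = eval-zero f L p z l eq
  alt≡coef ((u , v) ∷ʳ τ) f L p z l eq = alt≡coef τ f L p (z ⊕ u) l eq
  alt≡coef {S = _ ∷ S} (_∷_ {x = u , v} refl τ) f L p z l eq = begin
    alt τ p (z ⊕ u) - alt τ p (z ⊕ v)
      ≡⟨ cong₂ _-_ (alt-⊕ τ p z u) (alt-⊕ τ p z v) ⟩
    (alt τ p z + alt τ (Δ[ u ] p) z) - (alt τ p z + alt τ (Δ[ v ] p) z)
      ≡⟨ lemma₁ (alt τ p z) _ _ ⟩
    alt τ (Δ[ u ] p) z - alt τ (Δ[ v ] p) z
      ≡⟨ cong₂ _-_ (step u) (step v) ⟩
    coef S (f ⊖ u) * ∏ L - coef S (f ⊖ v) * ∏ L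
      ≡⟨ lemma₂ (coef S (f ⊖ u)) (coef S (f ⊖ v)) (∏ L) ⟩
    (coef S (f ⊖ u) - coef S (f ⊖ v)) * ∏ L ∎
    where
    open ≡-Reasoning
    lemma₁ : ∀ a b c → (a + b) - (a + c) ≡ b - c
    lemma₁ = solve-∀
    lemma₂ : ∀ a b c → a * c - b * c ≡ (a - b) * c
    lemma₂ = solve-∀
    lemma₃ : ∀ a → a ≡ a + 1ℤ - 1ℤ
    lemma₃ = solve-∀
    step : ∀ w → alt τ (Δ[ w ] p) z ≡ coef S (f ⊖ w) * ∏ L
    step w = alt≡coef τ (f ⊖ w) L (Δ[ w ] p) z (Lead-Δ[] w {f} {L} {p} l)
      (trans (lemma₃ (∑ (f ⊖ w))) (cong (_- 1ℤ) (trans (∑-⊖ f w) eq)))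

  -- The vectors reached are out-degree vectors, each edge crediting the end that it leaves. With
  -- `X` arbitrary, an edge list can be handled in blocks, the condition for one block serving as
  -- `X` for the block before it.
  Closed : ∀ {n} → Edges n → ((Fin n → ℤ) → Set) → (Fin n → ℤ) → Set
  Closed []            X z = X z
  Closed ((u , v) ∷ E) X z = Closed E X (z ⊕ u) × Closed E X (z ⊕ v)

  alt-nonzero : ∀ {n} {S E : Edges n} (τ : S ⊆ E) p X z → Closed E X z → alt τ p z ≢ 0ℤ →
                ∃ λ x → X x × eval p x ≢ 0ℤ
  alt-nonzero [] p X z cl a≢0 = z , cl , a≢0
  alt-nonzero ((u , v) ∷ʳ τ) p X z (cl , _) a≢0 = alt-nonzero τ p X (z ⊕ u) cl a≢0
  alt-nonzero (_∷_ {x = u , v} refl τ) p X z (clu , clv) a≢0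
    with alt τ p (z ⊕ u) ℤₚ.≟ 0ℤ | alt τ p (z ⊕ v) ℤₚ.≟ 0ℤ
  ... | no au≢0 | _ = alt-nonzero τ p X (z ⊕ u) clu au≢0
  ... | yes _ | no av≢0 = alt-nonzero τ p X (z ⊕ v) clv av≢0
  ... | yes au≡0 | yes av≡0 = contradiction (cong₂ _-_ au≡0 av≡0) a≢0

  -- Peeling off vertex zero

  up : ∀ {n} → Edges n → Edges (suc n)
  up = map (λ { (u , v) → suc u , suc v })

  star : ∀ {n} → List (Fin n) → Edges (suc n)
  star = map (λ v → zero , suc v)

  coef-up : ∀ {n} (S : Edges n) f → f zero ≡ 0ℤ → coef (up S) f ≡ coef S (f ∘ suc)
  coef-up []            f eq = trans (cong (λ a → isZero a * ∏ (isZero ∘ f ∘ suc)) eq) (ℤₚ.*-identityˡ _)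
  coef-up ((u , v) ∷ S) f eq =
    cong₂ _-_ (coef-up S (f ⊖ suc u) (trans (ℤₚ.+-identityʳ _) eq))
              (coef-up S (f ⊖ suc v) (trans (ℤₚ.+-identityʳ _) eq))

  coef-up-zero : ∀ {n} (S : Edges n) f → f zero ≢ 0ℤ → coef (up S) f ≡ 0ℤ
  coef-up-zero [] f ne with f zero
  ... | + 0     = contradiction refl ne
  ... | + suc k = ℤₚ.*-zeroˡ (∏ (isZero ∘ f ∘ suc))
  ... | -[1+ k ] = ℤₚ.*-zeroˡ (∏ (isZero ∘ f ∘ suc))
  coef-up-zero ((u , v) ∷ S) f ne =
    cong₂ _-_ (coef-up-zero S (f ⊖ suc u) (ne ∘ trans (sym (ℤₚ.+-identityʳ _))))
              (coef-up-zero S (f ⊖ suc v) (ne ∘ trans (sym (ℤₚ.+-identityʳ _))))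

  signed : ∀ {n} → Edges n → (Fin n → ℤ) → List (Fin n) → ℤ
  signed S f []      = coef S f
  signed S f (v ∷ R) = - signed S (f ⊖ v) R

  signed-cong : ∀ {n} (S : Edges n) {f g} → f ≗ g → ∀ R → signed S f R ≡ signed S g R
  signed-cong S f≗g []      = coef-cong S f≗g
  signed-cong S f≗g (v ∷ R) = cong -_ (signed-cong S (λ x → cong (_- δ v x) (f≗g x)) R)

  signed-nonzero : ∀ {n} (S : Edges n) f R → coef S (foldl _⊖_ f R) ≢ 0ℤ → signed S f R ≢ 0ℤ
  signed-nonzero S f []      ne = ne
  signed-nonzero S f (v ∷ R) ne eq =
    signed-nonzero S (f ⊖ v) R ne (ℤₚ.neg-injective eq)

  coef-star-zero : ∀ {n} (A : List (Fin n)) S f → + length A ℤ.< f zero → coef (star A ++ up S) f ≡ 0ℤ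
  coef-star-zero []      S f lt = coef-up-zero S f (λ eq → ℤₚ.<-irrefl (sym eq) lt)
  coef-star-zero (v ∷ A) S f lt =
    cong₂ _-_ (coef-star-zero A S (f ⊖ zero)
                (subst (ℤ._< f zero - 1ℤ) (lemma (+ length A)) (ℤₚ.+-monoˡ-< (- 1ℤ) lt)))
              (coef-star-zero A S (f ⊖ suc v)
                (subst (+ length A ℤ.<_) (sym (ℤₚ.+-identityʳ (f zero)))
                  (ℤₚ.<-trans (ℤ.+<+ (ℕₚ.n<1+n (length A))) lt)))
    where
    lemma : ∀ a → 1ℤ + a - 1ℤ ≡ a
    lemma = solve-∀

  -- Extracting the exponent of vertex zero leaves k of its edges to the other endpoint.
  coef-star : ∀ {n} (A : List (Fin n)) S f k → f zero + + k ≡ + length A →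
              coef (star A ++ up S) f ≡ ∑⊆ k A (signed S (f ∘ suc))
  coef-star [] S f zero    eq = coef-up S f (trans (sym (ℤₚ.+-identityʳ _)) eq)
  coef-star [] S f (suc k) eq = coef-up-zero S f λ f₀≡0 →
    contradiction (trans (cong (_+ + suc k) (sym f₀≡0)) eq) λ ()
  coef-star (v ∷ A) S f k eq = helper k eq
    where
    lemma₁ : ∀ a k l → a + k ≡ 1ℤ + l → a - 1ℤ + k ≡ l
    lemma₁ a k l eq = trans (r₁ a k) (trans (cong (_- 1ℤ) eq) (r₂ l))
      where
      r₁ : ∀ a k → a - 1ℤ + k ≡ a + k - 1ℤ
      r₁ = solve-∀
      r₂ : ∀ l → 1ℤ + l - 1ℤ ≡ l
      r₂ = solve-∀

    first : ∀ k → f zero + + k ≡ + suc (length A) →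
            coef (star A ++ up S) (f ⊖ zero) ≡ ∑⊆ k A (signed S (f ∘ suc))
    first k eq = trans (coef-star A S (f ⊖ zero) k (lemma₁ (f zero) (+ k) (+ length A) eq))
                       (∑⊆-cong k A (signed-cong S (λ x → ℤₚ.+-identityʳ (f (suc x)))))

    helper : ∀ k → f zero + + k ≡ + suc (length A) →
             coef (star A ++ up S) (f ⊖ zero) - coef (star A ++ up S) (f ⊖ suc v)
               ≡ ∑⊆ k (v ∷ A) (signed S (f ∘ suc))
    helper zero eq = trans
      (cong₂ _-_ (first zero eq)
        (coef-star-zero A S (f ⊖ suc v)
          (subst (+ length A ℤ.<_) (sym eq) (ℤ.+<+ (ℕₚ.n<1+n (length A))))))
      (ℤₚ.+-identityʳ _)
    helper (suc k) eq = trans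
      (cong₂ _-_ (first (suc k) eq)
        (coef-star A S (f ⊖ suc v) k
          (lemma₂ (f zero) (+ k) (+ length A) eq)))
      (trans (ℤₚ.+-comm _ (- ∑⊆ k A (signed S (f ∘ suc ⊖ v))))
             (cong (_+ ∑⊆ (suc k) A (signed S (f ∘ suc))) (sym (∑⊆-neg k A (signed S (f ∘ suc ⊖ v))))))
      where
      lemma₂ : ∀ a k l → a + (1ℤ + k) ≡ 1ℤ + l → a - 0ℤ + k ≡ l
      lemma₂ a k l eq = trans (r a k) (lemma₁ a (1ℤ + k) l eq)
        where
        r : ∀ a k → a - 0ℤ + k ≡ a - 1ℤ + (1ℤ + k)
        r = solve-∀

  -- Nonvanishing by elimination of vertices

  sel : ∀ {m} → (Fin m → Bool) → List (Fin m)
  sel {zero}  p = []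
  sel {suc m} p = if p zero then zero ∷ map suc (sel (p ∘ suc)) else map suc (sel (p ∘ suc))

  length-sel : ∀ {m} (p : Fin m → Bool) → length (sel p) ≡ count p
  length-sel {zero}  p = refl
  length-sel {suc m} p with p zero
  ... | true  = cong suc (trans (length-map Fin.suc (sel (p ∘ suc))) (length-sel (p ∘ suc)))
  ... | false = trans (length-map Fin.suc (sel (p ∘ suc))) (length-sel (p ∘ suc))

  sel-⊆ : ∀ {m} (p q : Fin m → Bool) → (∀ i → p i ≡ true → q i ≡ true) → sel p ⊆ sel q
  sel-⊆ {zero}  p q p⇒q = []
  sel-⊆ {suc m} p q p⇒q with p zero | q zero | p⇒q zero
  ... | true  | true  | _ = refl ∷ map⁺ suc (sel-⊆ (p ∘ suc) (q ∘ suc) (p⇒q ∘ suc))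
  ... | true  | false | c with () ← c refl
  ... | false | true  | _ = zero ∷ʳ map⁺ suc (sel-⊆ (p ∘ suc) (q ∘ suc) (p⇒q ∘ suc))
  ... | false | false | _ = map⁺ suc (sel-⊆ (p ∘ suc) (q ∘ suc) (p⇒q ∘ suc))

  𝟙 : Bool → ℕ
  𝟙 b = if b then 1 else 0

  foldl-⊖-suc : ∀ {n} (f : Fin (suc n) → ℤ) R x →
                foldl _⊖_ f (map suc R) (suc x) ≡ foldl _⊖_ (f ∘ suc) R x
  foldl-⊖-suc f []      x = refl
  foldl-⊖-suc f (v ∷ R) x = foldl-⊖-suc (f ⊖ suc v) R x

  foldl-⊖-zero : ∀ {n} (f : Fin (suc n) → ℤ) R → foldl _⊖_ f (map suc R) zero ≡ f zero
  foldl-⊖-zero f []      = refl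
  foldl-⊖-zero f (v ∷ R) = trans (foldl-⊖-zero (f ⊖ suc v) R) (ℤₚ.+-identityʳ _)

  foldl-⊖-sel : ∀ {n} (f : Fin n → ℤ) p x → foldl _⊖_ f (sel p) x ≡ f x - + 𝟙 (p x)
  foldl-⊖-sel {suc n} f p zero with p zero
  ... | true  = foldl-⊖-zero (f ⊖ zero) (sel (p ∘ suc))
  ... | false = trans (foldl-⊖-zero f (sel (p ∘ suc))) (sym (ℤₚ.+-identityʳ _))
  foldl-⊖-sel {suc n} f p (suc x) with p zero
  ... | true  = trans (foldl-⊖-suc (f ⊖ zero) (sel (p ∘ suc)) x)
                  (trans (foldl-⊖-sel ((f ⊖ zero) ∘ suc) (p ∘ suc) x)
                         (cong (_- + 𝟙 (p (suc x))) (ℤₚ.+-identityʳ (f (suc x)))))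
  ... | false = trans (foldl-⊖-suc f (sel (p ∘ suc)) x) (foldl-⊖-sel (f ∘ suc) (p ∘ suc) x)

  count-false : ∀ n → count {n} (λ _ → false) ≡ 0
  count-false zero    = refl
  count-false (suc n) = count-false n

  lt : ∀ {n} → Fin n → Fin n → Bool
  lt _       zero    = false
  lt zero    (suc _) = true
  lt (suc i) (suc j) = lt i j

  edges : ∀ {n} → (Fin n → Fin n → Bool) → Edges n
  edges {zero}  nb = []
  edges {suc n} nb = star (sel (nb zero ∘ suc)) ++ up (edges (λ i j → nb (suc i) (suc j)))

  -- Vertex i spends own i of its edges to larger vertices on itself, and two edges for each j > i
  -- with rs i j, whose exponent it raises by one.
  coef-nonzero : ∀ {n} (nb rs : Fin n → Fin n → Bool) (own : Fin n → ℕ) →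
    (∀ i j → rs i j ≡ true → nb i j ≡ true) →
    (∀ i → own i ℕ.+ 2 ℕ.* count (λ j → lt i j ∧ rs i j) ≡ count (λ j → lt i j ∧ nb i j)) →
    ∃ λ S → S ⊆ edges nb × coef S (λ j → + (own j ℕ.+ count (λ i → lt i j ∧ rs i j))) ≢ 0ℤ
  coef-nonzero {zero}  nb rs own rs⇒nb eq = [] , [] , λ ()
  coef-nonzero {suc n} nb rs own rs⇒nb eq
    with coef-nonzero (λ i j → nb (suc i) (suc j)) (λ i j → rs (suc i) (suc j)) (own ∘ suc)
           (λ i j → rs⇒nb (suc i) (suc j)) (eq ∘ suc)
  ... | S , S⊆ , c≢0 = answer
    where
    A R : List (Fin n)
    A = sel (nb zero ∘ suc)
    R = sel (rs zero ∘ suc)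
    k = length R
    h : Fin (suc n) → ℤ
    h j = + (own j ℕ.+ count (λ i → lt i j ∧ rs i j))
    φ = signed S (h ∘ suc)

    len : k ℕ.+ k ℕ.+ own zero ≡ length A
    len = trans (trans (cong (λ c → c ℕ.+ c ℕ.+ own zero) (length-sel (rs zero ∘ suc)))
                       (lemma (count (rs zero ∘ suc)) (own zero)))
                (trans (eq zero) (sym (length-sel (nb zero ∘ suc))))
      where
      lemma : ∀ k o → k ℕ.+ k ℕ.+ o ≡ o ℕ.+ 2 ℕ.* k
      lemma = ℕ-Ring.solve-∀

    φR≢0 : φ R ≢ 0ℤ
    -- Lowering `h` by one on `R` takes back what vertex zero gives away, leaving exactly the
    -- exponents of the induction hypothesis.
    φR≢0 = signed-nonzero S (h ∘ suc) R (λ c≡0 → c≢0 (trans (sym (coef-cong S pointwise)) c≡0))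
      where
      lemma : ∀ a b c → a + (b + c) - b ≡ a + c
      lemma = solve-∀
      pointwise : ∀ x → foldl _⊖_ (h ∘ suc) R x ≡
                        + (own (suc x) ℕ.+ count (λ i → lt i x ∧ rs (suc i) (suc x)))
      pointwise x = trans (foldl-⊖-sel (h ∘ suc) (rs zero ∘ suc) x)
        (lemma (+ own (suc x)) (+ 𝟙 (rs zero (suc x))) (+ count (λ i → lt i x ∧ rs (suc i) (suc x))))

    h₀ : h zero ≡ + own zero
    h₀ = cong +_ (trans (cong (own zero ℕ.+_) (count-false n)) (ℕₚ.+-identityʳ _))

    answer : ∃ λ S′ → S′ ⊆ edges nb × coef S′ h ≢ 0ℤ
    -- By `len`, `A` has exactly the size that the rank condition requires. Of the `k + own zero`
    -- edges in the set `B` found, `own zero` go to vertex zero; the sum runs over the possible `k`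
    -- others, with `R` as one of the candidates.
    answer with ∑⊆-nonzero A k (own zero) φ (ℕₚ.≤-reflexive len) R
                  (sel-⊆ (rs zero ∘ suc) (nb zero ∘ suc) (λ i → rs⇒nb zero (suc i))) refl φR≢0
    ... | B , B⊆A , lenB , w≢0 =
      star B ++ up S , ++⁺ (map⁺ _ B⊆A) (map⁺ _ S⊆) ,
      λ c≡0 → w≢0 (trans (sym (coef-star B S h k
        (trans (cong (_+ + k) h₀) (cong +_ (trans (ℕₚ.+-comm (own zero) k) (sym lenB)))))) c≡0)

  -- Out-degree vectors of orientations

  -- Only the values s v w with v < w matter: they say whether the edge leaves its smaller end.
  toArc : ∀ {n} → (nb s : Fin n → Fin n → Bool) → Fin n → Fin n → Bool
  toArc nb s v w = if lt v w then nb v w ∧ s v w else (if lt w v then nb w v ∧ not (s w v) else false)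

  OutVec : ∀ {n} → (Fin n → Fin n → Bool) → (Fin n → ℤ) → Set
  OutVec {n} nb x = ∃ λ (s : Fin n → Fin n → Bool) → ∀ v → x v ≡ + count (toArc nb s v)

  Closed-++ : ∀ {n} (E E′ : Edges n) X z → Closed E (Closed E′ X) z → Closed (E ++ E′) X z
  Closed-++ []            E′ X z cl          = cl
  Closed-++ ((u , v) ∷ E) E′ X z (clu , clv) = Closed-++ E E′ X (z ⊕ u) clu , Closed-++ E E′ X (z ⊕ v) clv

  -- The increments along `E` do not depend on the starting vector, so the condition compares
  -- differences: `z` already carries what the star has contributed, whereas `y` starts afresh.
  Closed-up : ∀ {n} (E : Edges n) X X′ y z → Closed E X y →
    (∀ x z′ → X x → z′ zero ≡ z zero → (∀ j → z′ (suc j) - x j ≡ z (suc j) - y j) → X′ z′) →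
    Closed (up E) X′ z
  Closed-up []            X X′ y z cl          imp = imp y z cl refl (λ _ → refl)
  Closed-up {n} ((u , v) ∷ E) X X′ y z (clu , clv) imp = step u clu , step v clv
    where
    lemma : ∀ a b c → a + c - (b + c) ≡ a - b
    lemma = solve-∀
    step : ∀ w → Closed E X (y ⊕ w) → Closed (up E) X′ (z ⊕ suc w)
    step w cl = Closed-up E X X′ (y ⊕ w) (z ⊕ suc w) cl λ x z′ Xx eq₀ eq →
      imp x z′ Xx (trans eq₀ (ℤₚ.+-identityʳ _))
        (λ j → trans (eq j) (lemma (z (suc j)) (y j) (δ w j)))

  -- The map `ι` keeps the names of the endpoints in `Fin n` while the recursion shortens the range
  -- `Fin m` of candidate neighbours. A true bit of `s` credits vertex zero.
  shift : ∀ {m n} → (p s : Fin m → Bool) → (Fin m → Fin n) → (Fin (suc n) → ℤ) → Fin (suc n) → ℤ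
  shift {zero}  p s ι z = z
  shift {suc m} p s ι z = shift (p ∘ suc) (s ∘ suc) (ι ∘ suc)
    (if p zero then (if s zero then z ⊕ zero else z ⊕ suc (ι zero)) else z)

  Closed-star : ∀ {m n} (p : Fin m → Bool) (ι : Fin m → Fin n) X z →
    (∀ s → X (shift p s ι z)) → Closed (star (map ι (sel p))) X z
  Closed-star {zero}  p ι X z all = all (λ ())
  Closed-star {suc m} p ι X z all with p zero
  ... | true  = subst (λ l → Closed (star l) X (z ⊕ zero)) (map-∘ (sel (p ∘ suc)))
                  (Closed-star (p ∘ suc) (ι ∘ suc) X (z ⊕ zero) (λ s → all (true F.∷ s)))
              , subst (λ l → Closed (star l) X (z ⊕ suc (ι zero))) (map-∘ (sel (p ∘ suc)))
                  (Closed-star (p ∘ suc) (ι ∘ suc) X (z ⊕ suc (ι zero)) (λ s → all (false F.∷ s)))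
  -- There is no edge at this position, so the bit put in front of `s` is arbitrary.
  ... | false = subst (λ l → Closed (star l) X z) (map-∘ (sel (p ∘ suc)))
                  (Closed-star (p ∘ suc) (ι ∘ suc) X z (λ s → all (true F.∷ s)))

  shift-zero : ∀ {m n} (p s : Fin m → Bool) (ι : Fin m → Fin n) z →
               shift p s ι z zero ≡ z zero + + count (λ i → p i ∧ s i)
  shift-zero {zero}  p s ι z = sym (ℤₚ.+-identityʳ _)
  shift-zero {suc m} p s ι z with p zero | s zero
  ... | true  | true  = trans (shift-zero (p ∘ suc) (s ∘ suc) (ι ∘ suc) (z ⊕ zero))
                              (ℤₚ.+-assoc (z zero) 1ℤ _)
  ... | true  | false = trans (shift-zero (p ∘ suc) (s ∘ suc) (ι ∘ suc) (z ⊕ suc (ι zero)))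
                              (cong (_+ _) (ℤₚ.+-identityʳ (z zero)))
  ... | false | _     = shift-zero (p ∘ suc) (s ∘ suc) (ι ∘ suc) z

  shift-suc : ∀ {m n} (p s : Fin m → Bool) (ι : Fin m → Fin n) z x →
              shift p s ι z (suc x) ≡ z (suc x) + ∑ (λ i → if p i ∧ not (s i) then δ (ι i) x else 0ℤ)
  shift-suc {zero}  p s ι z x = sym (ℤₚ.+-identityʳ _)
  shift-suc {suc m} p s ι z x with p zero | s zero
  ... | true  | true  = trans (shift-suc (p ∘ suc) (s ∘ suc) (ι ∘ suc) (z ⊕ zero) x)
                              (ℤₚ.+-assoc (z (suc x)) 0ℤ _)
  ... | true  | false = trans (shift-suc (p ∘ suc) (s ∘ suc) (ι ∘ suc) (z ⊕ suc (ι zero)) x)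
                              (ℤₚ.+-assoc (z (suc x)) (δ (ι zero) x) _)
  ... | false | _     = trans (shift-suc (p ∘ suc) (s ∘ suc) (ι ∘ suc) z x)
                              (cong (_+_ (z (suc x))) (sym (ℤₚ.+-identityˡ _)))

  ∑-if-δ : ∀ {n} (q : Fin n → Bool) x → ∑ (λ i → if q i then δ i x else 0ℤ) ≡ + 𝟙 (q x)
  ∑-if-δ {suc n} q zero = trans
    (cong₂ _+_ (head (q zero)) (trans (∑ℤ.sum-cong-≗ (λ i → tail (q (suc i)))) (∑ℤ.sum-replicate-zero n)))
    (ℤₚ.+-identityʳ _)
    where
    head : ∀ b → (if b then 1ℤ else 0ℤ) ≡ + 𝟙 b
    head true  = refl
    head false = refl
    tail : ∀ b → (if b then 0ℤ else 0ℤ) ≡ 0ℤ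
    tail true  = refl
    tail false = refl
  ∑-if-δ {suc n} q (suc x) with q zero
  ... | true  = trans (ℤₚ.+-identityˡ _) (∑-if-δ (q ∘ suc) x)
  ... | false = trans (ℤₚ.+-identityˡ _) (∑-if-δ (q ∘ suc) x)

  Closed-edges : ∀ {n} (nb : Fin n → Fin n → Bool) → Closed (edges nb) (OutVec nb) (λ _ → 0ℤ)
  Closed-edges {zero}  nb = (λ ()) , λ ()
  Closed-edges {suc n} nb = Closed-++ (star (sel a)) (up E′) (OutVec nb) (λ _ → 0ℤ)
    (subst (λ l → Closed (star l) (Closed (up E′) (OutVec nb)) (λ _ → 0ℤ)) (map-id (sel a))
      (Closed-star a id _ (λ _ → 0ℤ) λ s →
        Closed-up E′ (OutVec nb′) (OutVec nb) (λ _ → 0ℤ) _ (Closed-edges nb′) (extend s)))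
    where
    a = nb zero ∘ suc
    nb′ : Fin n → Fin n → Bool
    nb′ i j = nb (suc i) (suc j)
    E′ = edges nb′

    extend : ∀ s x z′ → OutVec nb′ x → z′ zero ≡ shift a s id (λ _ → 0ℤ) zero →
      (∀ j → z′ (suc j) - x j ≡ shift a s id (λ _ → 0ℤ) (suc j) - 0ℤ) → OutVec nb z′
    extend s x z′ (s′ , x≡) eq₀ eq = t , λ
      { zero → trans eq₀ (trans (shift-zero a s id (λ _ → 0ℤ)) (ℤₚ.+-identityˡ _))
      ; (suc j) → trans (lemma (z′ (suc j)) (x j))
          (cong₂ _+_ (trans (eq j) (trans (ℤₚ.+-identityʳ _)
                       (trans (shift-suc a s id (λ _ → 0ℤ) j)
                         (trans (ℤₚ.+-identityˡ _) (∑-if-δ (λ i → a i ∧ not (s i)) j)))))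
                     (x≡ j)) }
      where
      lemma : ∀ a b → a ≡ a - b + b
      lemma = solve-∀
      t : Fin (suc n) → Fin (suc n) → Bool
      t zero    (suc j) = s j
      t (suc i) (suc j) = s′ i j
      t _       zero    = false

  -- The Combinatorial Nullstellensatz for out-degree vectors

  roots-∈ : ∀ {c cs} → c ∈ cs → roots cs (+ c) ≡ 0ℤ
  roots-∈ {c} {cs = _ ∷ cs} (here refl) = trans (cong (_* roots cs (+ c)) (ℤₚ.+-inverseʳ (+ c))) (ℤₚ.*-zeroˡ (roots cs (+ c)))
  roots-∈ {c} {cs = d ∷ cs} (there c∈) = trans (cong (_*_ (+ c - + d)) (roots-∈ c∈)) (ℤₚ.*-zeroʳ (+ c - + d))

  ∏-nonzero : ∀ {n} (f : Fin n → ℤ) → ∏ f ≢ 0ℤ → ∀ v → f v ≢ 0ℤ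
  ∏-nonzero {suc n} f ne zero    eq = ne (trans (cong (_* ∏ (f ∘ suc)) eq) (ℤₚ.*-zeroˡ (∏ (f ∘ suc))))
  ∏-nonzero {suc n} f ne (suc v) eq =
    ∏-nonzero (f ∘ suc) (λ eq′ → ne (trans (cong (_*_ (f zero)) eq′) (ℤₚ.*-zeroʳ (f zero)))) v eq

  nonzero-∏ : ∀ {n} (f : Fin n → ℤ) → (∀ v → f v ≢ 0ℤ) → ∏ f ≢ 0ℤ
  nonzero-∏ {suc n} f ne eq with ℤₚ.i*j≡0⇒i≡0∨j≡0 (f zero) eq
  ... | inj₁ eq₀ = ne zero eq₀
  ... | inj₂ eq′ = nonzero-∏ (f ∘ suc) (ne ∘ suc) eq′

  -- Give each `v` a monic polynomial of degree `h v` that vanishes on `F v`. By `alt≡coef` the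
  -- signed sum of the products of their values is the coefficient times the product of the
  -- factorials of `h v`. It is nonzero, so at some out-degree vector no factor vanishes.
  nullstellensatz : ∀ {n} (nb : Fin n → Fin n → Bool) (F : Fin n → List ℕ) (h : Fin n → ℕ) S →
    S ⊆ edges nb → coef S (+_ ∘ h) ≢ 0ℤ → (∀ v → length (F v) ℕ.≤ h v) →
    ∃ λ s → ∀ v → count (toArc nb s v) ∉ F v
  nullstellensatz {n} nb F h S S⊆ c≢0 le
    with alt-nonzero S⊆ p (OutVec nb) (λ _ → 0ℤ) (Closed-edges nb) alt≢0
    module CN where
    padded : Fin n → List ℕ
    -- The degree has to be exactly `h v`; surplus roots only forbid more, and 0 is an arbitrary
    -- choice for them.
    padded v = F v ++ replicate (h v ℕ.∸ length (F v)) 0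
    p : Fin n → ℤ → ℤ
    p v = roots (padded v)
    length-padded : ∀ v → length (padded v) ≡ h v
    length-padded v = trans (length-++ (F v))
      (trans (cong (length (F v) ℕ.+_) (length-replicate (h v ℕ.∸ length (F v)))) (ℕₚ.m+[n∸m]≡n (le v)))
    lead : ∀ v → Lead (+ h v) (p v) (fact (h v))
    lead v = subst (λ a → Lead (+ a) (p v) (fact a)) (length-padded v) (Lead-roots (padded v))
    alt≢0 : alt S⊆ p (λ _ → 0ℤ) ≢ 0ℤ
    alt≢0 eq with ℤₚ.i*j≡0⇒i≡0∨j≡0 (coef S (+_ ∘ h))
      (trans (sym (alt≡coef S⊆ (+_ ∘ h) (fact ∘ h) p (λ _ → 0ℤ) lead (coef-degree S _ c≢0))) eq)
    ... | inj₁ c≡0 = c≢0 c≡0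
    ... | inj₂ L≡0 = nonzero-∏ (fact ∘ h) (fact≢0 ∘ h) L≡0
  ... | x , (s , x≡) , e≢0 = s , λ v out∈ → ∏-nonzero (λ v → CN.p nb F h S S⊆ c≢0 le v (x v)) e≢0 v
          (trans (cong (CN.p nb F h S S⊆ c≢0 le v) (x≡ v)) (roots-∈ (∈-++⁺ˡ out∈)))

module _ where
  open import Data.Nat.Base using (_+_; _*_; _≤_; _<_; z≤n; s≤s)
  open ℕₚ hiding (_≟_)

  -- Thinning a digraph to a third of its degrees

  sum-mono : ∀ {n} {f g : Fin n → ℕ} → (∀ i → f i ≤ g i) → sum f ≤ sum g
  sum-mono {zero}  le = z≤n
  sum-mono {suc n} le = +-mono-≤ (le zero) (sum-mono (le ∘ suc))

  sum-mono-< : ∀ {n} {f g : Fin n → ℕ} → (∀ i → f i ≤ g i) → ∀ a → f a < g a → sum f < sum g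
  sum-mono-< le zero    lt = +-mono-<-≤ lt (sum-mono (le ∘ suc))
  sum-mono-< le (suc a) lt = +-mono-≤-< (le zero) (sum-mono-< (le ∘ suc) a lt)

  sum-* : ∀ {n} k (f : Fin n → ℕ) → sum (λ i → k * f i) ≡ k * sum f
  sum-* {zero}  k f = sym (*-zeroʳ k)
  sum-* {suc n} k f = trans (cong (k * f zero +_) (sum-* k (f ∘ suc))) (sym (*-distribˡ-+ k (f zero) _))

  sum-single : ∀ {n} a (g : Fin n → ℕ) → sum (λ v → if does (a ≟ v) then g v else 0) ≡ g a
  sum-single {suc n} zero    g = trans (cong (g zero +_) (sum-replicate-zero n)) (+-identityʳ _)
  sum-single {suc n} (suc a) g = sum-single a (g ∘ suc)

  sum₂ : ∀ {n} → (Fin n → Fin n → ℕ) → ℕ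
  sum₂ f = sum λ v → sum (f v)

  sum₂-mono : ∀ {n} {f g : Fin n → Fin n → ℕ} → (∀ v w → f v w ≤ g v w) → sum₂ f ≤ sum₂ g
  sum₂-mono le = sum-mono λ v → sum-mono (le v)

  sum₂-+ : ∀ {n} (f g : Fin n → Fin n → ℕ) → sum₂ (λ v w → f v w + g v w) ≡ sum₂ f + sum₂ g
  sum₂-+ f g = trans (sum-cong-≗ (λ v → ∑-distrib-+ (f v) (g v)))
                     (∑-distrib-+ (λ v → sum (f v)) (λ v → sum (g v)))

  sum₂-single : ∀ {n} a b (g : Fin n → Fin n → ℕ) →
    sum₂ (λ v w → if does (a ≟ v) then (if does (b ≟ w) then g v w else 0) else 0) ≡ g a b
  sum₂-single {n} a b g = trans (sum-cong-≗ inner) (sum-single a (λ v → g v b))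
    where
    inner : ∀ v → sum (λ w → if does (a ≟ v) then (if does (b ≟ w) then g v w else 0) else 0) ≡
                  (if does (a ≟ v) then g v b else 0)
    inner v with does (a ≟ v)
    ... | true  = sum-single b (g v)
    ... | false = sum-replicate-zero n

  -- Degree-constrained subrelations and the cut condition

  Rel : ℕ → Set
  Rel n = Fin n → Fin n → Bool

  delete : ∀ {n} → Fin n → Fin n → Rel n → Rel n
  delete a b E v w = E v w ∧ not (does (a ≟ v) ∧ does (b ≟ w))

  size : ∀ {n} → Rel n → ℕ
  size E = sum₂ (λ v w → 𝟙 (E v w))

  𝟙-∧ˡ : ∀ b c → 𝟙 (b ∧ c) ≤ 𝟙 b
  𝟙-∧ˡ true  true  = ≤-refl
  𝟙-∧ˡ true  false = z≤n
  𝟙-∧ˡ false c     = ≤-refl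

  delete-self : ∀ {n} (a b : Fin n) E → delete a b E a b ≡ false
  delete-self a b E with a ≟ a | b ≟ b
  ... | yes _ | yes _ = Boolₚ.∧-zeroʳ (E a b)
  ... | no ne | _     = contradiction refl ne
  ... | _     | no ne = contradiction refl ne

  size-delete : ∀ {n} (a b : Fin n) E → E a b ≡ true → size (delete a b E) < size E
  size-delete a b E Eab =
    sum-mono-< (λ v → sum-mono (le v)) a (sum-mono-< (le a) b
      (subst₂ (λ x y → 𝟙 x < 𝟙 y) (sym (delete-self a b E)) (sym Eab) ≤-refl))
    where
    le : ∀ v w → 𝟙 (delete a b E v w) ≤ 𝟙 (E v w)
    le v w = 𝟙-∧ˡ (E v w) _

  module _ {n} (A B : Fin n → ℕ) where

    weight : (Fin n → ℕ) → Subset n → ℕ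
    weight C X = sum (λ v → if lookup X v then C v else 0)

    cut : Rel n → Subset n → Subset n → ℕ
    cut E X Y = sum₂ (λ v w → 𝟙 (E v w ∧ (not (lookup X v) ∧ lookup Y w)))

    -- The min-cut condition of a bipartite flow with capacity `A` at the tails and demand `B` at
    -- the heads: the demand of `Y` is met through tails in `X`, up to their capacities, and along
    -- single arcs from tails outside `X`.
    Feasible Deficient : Rel n → Set
    Feasible  E = ∀ X Y → weight B Y ≤ weight A X + cut E X Y
    Deficient E = ∃₂ λ X Y → weight A X + cut E X Y < weight B Y

    Tight : Rel n → Subset n → Subset n → Set
    Tight E X Y = weight A X + cut E X Y ≤ weight B Y

    feasible? : ∀ E → Feasible E ⊎ Deficient E
    feasible? E with anySubset? (λ X → anySubset? (λ Y → weight A X + cut E X Y <? weight B Y))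
    ... | yes d = inj₂ d
    ... | no ¬d = inj₁ λ X Y → ≮⇒≥ λ lt → ¬d (X , Y , lt)

    feasible-dec : ∀ E → Dec (Feasible E)
    feasible-dec E with feasible? E
    ... | inj₁ f = yes f
    ... | inj₂ (X , Y , lt) = no λ f → <⇒≱ lt (f X Y)

    -- Deleting one arc lowers a cut by at most one, so a pair violated afterwards was tight before.
    -- The arc must have counted in that cut, which places `a` outside `X` and `b` inside `Y`.
    essential⇒tight : ∀ E a b → Feasible E → Deficient (delete a b E) →
      ∃₂ λ X Y → lookup X a ≡ false × lookup Y b ≡ true × Tight E X Y
    essential⇒tight E a b feas (X , Y , lt) = X , Y , split (lookup X a) (lookup Y b) refl refl
      where
      m : Rel n
      m v w = not (lookup X v) ∧ lookup Y w
      pointwise : ∀ v w → 𝟙 (E v w ∧ m v w) ≤ 𝟙 (delete a b E v w ∧ m v w) +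
        (if does (a ≟ v) then (if does (b ≟ w) then 𝟙 (m v w) else 0) else 0)
      pointwise v w with E v w | does (a ≟ v) | does (b ≟ w)
      ... | false | _     | _     = z≤n
      ... | true  | true  | true  = ≤-refl
      ... | true  | true  | false = m≤m+n _ 0
      ... | true  | false | _     = m≤m+n _ 0
      cut≤ : cut E X Y ≤ cut (delete a b E) X Y + 𝟙 (m a b)
      cut≤ = ≤-trans (sum₂-mono pointwise) (≤-reflexive
        (trans (sum₂-+ (λ v w → 𝟙 (delete a b E v w ∧ m v w)) _)
               (cong (cut (delete a b E) X Y +_) (sum₂-single a b (λ v w → 𝟙 (m v w))))))
      useless : 𝟙 (m a b) ≡ 0 → weight A X + cut E X Y < weight B Y
      useless eq = ≤-<-trans (+-monoʳ-≤ (weight A X)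
        (≤-trans cut≤ (≤-reflexive (trans (cong (cut (delete a b E) X Y +_) eq) (+-identityʳ _))))) lt
      split : ∀ x y → lookup X a ≡ x → lookup Y b ≡ y →
        x ≡ false × y ≡ true × Tight E X Y
      split false true ex ey = refl , refl , ≤-trans (+-monoʳ-≤ (weight A X) cut≤)
        (≤-trans (≤-reflexive (trans (cong (λ t → weight A X + (cut (delete a b E) X Y + t))
                                       (cong₂ (λ x y → 𝟙 (not x ∧ y)) ex ey))
                                     (lemma (weight A X) (cut (delete a b E) X Y)))) lt)
        where
        lemma : ∀ p q → p + (q + 1) ≡ 1 + (p + q)
        lemma = ℕ-Ring.solve-∀
      split false false ex ey =
        contradiction (feas X Y) (<⇒≱ (useless (cong₂ (λ x y → 𝟙 (not x ∧ y)) ex ey)))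
      split true y ex ey =
        contradiction (feas X Y) (<⇒≱ (useless (cong₂ (λ x y → 𝟙 (not x ∧ y)) ex ey)))

    lookup-∪ : ∀ (X X′ : Subset n) v → lookup (X ∪ X′) v ≡ lookup X v ∨ lookup X′ v
    lookup-∪ X X′ v = lookup-zipWith _∨_ v X X′

    lookup-∩ : ∀ (X X′ : Subset n) v → lookup (X ∩ X′) v ≡ lookup X v ∧ lookup X′ v
    lookup-∩ X X′ v = lookup-zipWith _∧_ v X X′

    weight-modular : ∀ C X X′ → weight C (X ∪ X′) + weight C (X ∩ X′) ≡ weight C X + weight C X′
    weight-modular C X X′ =
      trans (sym (∑-distrib-+ (λ v → if lookup (X ∪ X′) v then C v else 0) _))
      (trans (sum-cong-≗ pointwise) (∑-distrib-+ (λ v → if lookup X v then C v else 0) _))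
      where
      cases : ∀ x y c → (if x ∨ y then c else 0) + (if x ∧ y then c else 0) ≡
                        (if x then c else 0) + (if y then c else 0)
      cases true  true  c = refl
      cases true  false c = refl
      cases false true  c = +-comm c 0
      cases false false c = refl
      pointwise : ∀ v → (if lookup (X ∪ X′) v then C v else 0) + (if lookup (X ∩ X′) v then C v else 0) ≡
                        (if lookup X v then C v else 0) + (if lookup X′ v then C v else 0)
      pointwise v rewrite lookup-∪ X X′ v | lookup-∩ X X′ v = cases (lookup X v) (lookup X′ v) (C v)

    cut-submodular : ∀ E X X′ Y Y′ →
      cut E (X ∪ X′) (Y ∪ Y′) + cut E (X ∩ X′) (Y ∩ Y′) ≤ cut E X Y + cut E X′ Y′
    cut-submodular E X X′ Y Y′ = subst₂ _≤_
      (sum₂-+ (λ v w → 𝟙 (E v w ∧ (not (lookup (X ∪ X′) v) ∧ lookup (Y ∪ Y′) w))) _)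
      (sum₂-+ (λ v w → 𝟙 (E v w ∧ (not (lookup X v) ∧ lookup Y w))) _)
      (sum₂-mono pointwise)
      where
      cases : ∀ e x x′ y y′ →
        𝟙 (e ∧ (not (x ∨ x′) ∧ (y ∨ y′))) + 𝟙 (e ∧ (not (x ∧ x′) ∧ (y ∧ y′))) ≤
        𝟙 (e ∧ (not x ∧ y)) + 𝟙 (e ∧ (not x′ ∧ y′))
      cases false x     x′    y     y′    = z≤n
      cases true  true  true  y     y′    = z≤n
      cases true  true  false true  y′    = ≤-refl
      cases true  true  false false y′    = z≤n
      cases true  false true  y     y′    = ≤-trans (𝟙-∧ˡ y y′) (m≤m+n (𝟙 y) 0)
      cases true  false false true  true  = ≤-refl
      cases true  false false true  false = ≤-refl
      cases true  false false false true  = ≤-refl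
      cases true  false false false false = ≤-refl
      pointwise : ∀ v w →
        𝟙 (E v w ∧ (not (lookup (X ∪ X′) v) ∧ lookup (Y ∪ Y′) w)) +
        𝟙 (E v w ∧ (not (lookup (X ∩ X′) v) ∧ lookup (Y ∩ Y′) w)) ≤
        𝟙 (E v w ∧ (not (lookup X v) ∧ lookup Y w)) + 𝟙 (E v w ∧ (not (lookup X′ v) ∧ lookup Y′ w))
      pointwise v w rewrite lookup-∪ X X′ v | lookup-∩ X X′ v | lookup-∪ Y Y′ w | lookup-∩ Y Y′ w =
        cases (E v w) (lookup X v) (lookup X′ v) (lookup Y w) (lookup Y′ w)

    -- Uncrossing: weights are modular, cuts are submodular, and feasibility of the intersections
    -- leaves no slack for the unions.
    tight-∪ : ∀ E X X′ Y Y′ → Feasible E → Tight E X Y → Tight E X′ Y′ → Tight E (X ∪ X′) (Y ∪ Y′)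
    tight-∪ E X X′ Y Y′ feas t t′ = +-cancelʳ-≤ (weight B (Y ∩ Y′)) _ _ (begin
      weight A (X ∪ X′) + cut E (X ∪ X′) (Y ∪ Y′) + weight B (Y ∩ Y′)
        ≤⟨ +-monoʳ-≤ _ (feas (X ∩ X′) (Y ∩ Y′)) ⟩
      weight A (X ∪ X′) + cut E (X ∪ X′) (Y ∪ Y′) + (weight A (X ∩ X′) + cut E (X ∩ X′) (Y ∩ Y′))
        ≡⟨ interchange (weight A (X ∪ X′)) _ _ _ ⟩
      weight A (X ∪ X′) + weight A (X ∩ X′) + (cut E (X ∪ X′) (Y ∪ Y′) + cut E (X ∩ X′) (Y ∩ Y′))
        ≤⟨ +-mono-≤ (≤-reflexive (weight-modular A X X′)) (cut-submodular E X X′ Y Y′) ⟩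
      weight A X + weight A X′ + (cut E X Y + cut E X′ Y′)
        ≡⟨ interchange (weight A X) _ _ _ ⟩
      weight A X + cut E X Y + (weight A X′ + cut E X′ Y′)
        ≤⟨ +-mono-≤ t t′ ⟩
      weight B Y + weight B Y′
        ≡⟨ sym (weight-modular B Y Y′) ⟩
      weight B (Y ∪ Y′) + weight B (Y ∩ Y′) ∎)
      where
      open ≤-Reasoning
      interchange : ∀ a b c d → a + b + (c + d) ≡ a + c + (b + d)
      interchange = ℕ-Ring.solve-∀

    empty : Subset n
    empty = tabulate (λ _ → false)

    weight-empty : ∀ C → weight C empty ≡ 0
    weight-empty C = trans (sum-cong-≗ (λ v → cong (if_then C v else 0) (lookup∘tabulate (λ _ → false) v)))
                           (sum-replicate-zero n)

    singleton : Fin n → Subset n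
    singleton a = tabulate (λ v → does (a ≟ v))

    weight-singleton : ∀ C a → weight C (singleton a) ≡ C a
    weight-singleton C a = trans
      (sum-cong-≗ (λ v → cong (if_then C v else 0) (lookup∘tabulate (λ v → does (a ≟ v)) v)))
      (sum-single a C)

    tight-empty : ∀ E → Tight E empty empty
    tight-empty E = ≤-trans (≤-reflexive (cong₂ _+_ (weight-empty A) cut≡0)) z≤n
      where
      cut≡0 : cut E empty empty ≡ 0
      cut≡0 = trans (sum-cong-≗ (λ v → trans
        (sum-cong-≗ (λ w → cong 𝟙 (trans
          (cong (λ y → E v w ∧ (not (lookup empty v) ∧ y)) (lookup∘tabulate (λ _ → false) w))
          (trans (cong (E v w ∧_) (Boolₚ.∧-zeroʳ _)) (Boolₚ.∧-zeroʳ _)))))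
        (sum-replicate-zero n))) (sum-replicate-zero n)

    feasible⇒in : ∀ E → Feasible E → ∀ w → B w ≤ sum (λ v → 𝟙 (E v w))
    feasible⇒in E feas b = begin
      B b                                          ≡⟨ sym (weight-singleton B b) ⟩
      weight B (singleton b)                       ≤⟨ feas empty (singleton b) ⟩
      weight A empty + cut E empty (singleton b)   ≡⟨ cong (_+ cut E empty (singleton b)) (weight-empty A) ⟩
      cut E empty (singleton b)                    ≡⟨ sum-cong-≗ row ⟩
      sum (λ v → 𝟙 (E v b))                        ∎
      where
      open ≤-Reasoning
      cases : ∀ e x → 𝟙 (e ∧ (true ∧ x)) ≡ (if x then 𝟙 e else 0)
      cases true  true  = refl
      cases true  false = refl
      cases false true  = refl
      cases false false = refl
      row : ∀ v → sum (λ w → 𝟙 (E v w ∧ (not (lookup empty v) ∧ lookup (singleton b) w))) ≡ 𝟙 (E v b)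
      row v = trans
        (sum-cong-≗ (λ w → trans
          (cong₂ (λ x y → 𝟙 (E v w ∧ (not x ∧ y)))
            (lookup∘tabulate (λ _ → false) v) (lookup∘tabulate (λ w → does (b ≟ w)) w))
          (cases (E v w) (does (b ≟ w)))))
        (sum-single b (λ w → 𝟙 (E v w)))

    -- Every edge out of a is blocked by a tight pair avoiding a; tight pairs are closed under union,
    -- and adding a to the union of them all shows that the out-degree is at most A a.
    minimal⇒out : ∀ E → Feasible E → (∀ a b → E a b ≡ true → Deficient (delete a b E)) →
                  ∀ a → sum (λ w → 𝟙 (E a w)) ≤ A a
    minimal⇒out E feas minimal a with closure (allFin n)
      where
      closure : ∀ ws → ∃₂ λ X Y → lookup X a ≡ false × Tight E X Y ×
                       (∀ w → w ∈ ws → E a w ≡ true → lookup Y w ≡ true)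
      closure [] = empty , empty , lookup∘tabulate (λ _ → false) a , tight-empty E , λ _ ()
      closure (b ∷ ws) with closure ws | E a b in Eab
      ... | X , Y , Xa , t , cov | false = X , Y , Xa , t , λ
        { w (here refl) Eaw → contradiction (trans (sym Eab) Eaw) λ ()
        ; w (there w∈) → cov w w∈ }
      ... | X , Y , Xa , t , cov | true with essential⇒tight E a b feas (minimal a b Eab)
      ... | X′ , Y′ , X′a , Y′b , t′ =
        X ∪ X′ , Y ∪ Y′ , trans (lookup-∪ X X′ a) (cong₂ _∨_ Xa X′a) , tight-∪ E X X′ Y Y′ feas t t′ , λ
        { w (here refl) Eaw → trans (lookup-∪ Y Y′ w) (trans (cong (lookup Y w ∨_) Y′b) (Boolₚ.∨-zeroʳ _))
        ; w (there w∈) Eaw → trans (lookup-∪ Y Y′ w) (cong (_∨ lookup Y′ w) (cov w w∈ Eaw)) }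
    ... | X , Y , Xa , t , cov = +-cancelʳ-≤ (weight A X + cut E X⁺ Y) _ _ (begin
      out + (weight A X + cut E X⁺ Y)
        ≡⟨ lemma₁ out (weight A X) _ ⟩
      weight A X + (cut E X⁺ Y + out)
        ≤⟨ +-monoʳ-≤ (weight A X) cut⁺ ⟩
      weight A X + cut E X Y
        ≤⟨ t ⟩
      weight B Y
        ≤⟨ feas X⁺ Y ⟩
      weight A X⁺ + cut E X⁺ Y
        ≡⟨ cong (_+ cut E X⁺ Y) weight⁺ ⟩
      (weight A X + A a) + cut E X⁺ Y
        ≡⟨ lemma₂ (weight A X) (A a) _ ⟩
      A a + (weight A X + cut E X⁺ Y) ∎)
      where
      open ≤-Reasoning
      lemma₁ : ∀ a b c → a + (b + c) ≡ b + (c + a)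
      lemma₁ = ℕ-Ring.solve-∀
      lemma₂ : ∀ a b c → (a + b) + c ≡ b + (a + c)
      lemma₂ = ℕ-Ring.solve-∀
      out = sum (λ w → 𝟙 (E a w))
      X⁺ : Subset n
      X⁺ = tabulate (λ v → does (a ≟ v) ∨ lookup X v)
      weight⁺ : weight A X⁺ ≡ weight A X + A a
      weight⁺ = trans (sum-cong-≗ pointwise)
        (trans (∑-distrib-+ (λ v → if lookup X v then A v else 0) _)
               (cong (weight A X +_) (sum-single a A)))
        where
        pointwise : ∀ v → (if lookup X⁺ v then A v else 0) ≡
          (if lookup X v then A v else 0) + (if does (a ≟ v) then A v else 0)
        pointwise v rewrite lookup∘tabulate (λ v → does (a ≟ v) ∨ lookup X v) v with a ≟ v
        ... | yes refl = cong (λ x → (if x then A a else 0) + A a) (sym Xa)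
        ... | no _     = sym (+-identityʳ _)
      row⁺ : ∀ v → sum (λ w → 𝟙 (E v w ∧ (not (lookup X⁺ v) ∧ lookup Y w))) +
                   (if does (a ≟ v) then sum (λ w → 𝟙 (E v w)) else 0) ≤
                   sum (λ w → 𝟙 (E v w ∧ (not (lookup X v) ∧ lookup Y w)))
      row⁺ v rewrite lookup∘tabulate (λ v → does (a ≟ v) ∨ lookup X v) v with a ≟ v
      ... | no _     = ≤-reflexive (+-identityʳ _)
      ... | yes refl = ≤-trans (≤-reflexive (cong (_+ out) (trans
              (sum-cong-≗ (λ w → cong 𝟙 (Boolₚ.∧-zeroʳ (E a w)))) (sum-replicate-zero n))))
              (sum-mono covered)
        where
        covered : ∀ w → 𝟙 (E a w) ≤ 𝟙 (E a w ∧ (not (lookup X a) ∧ lookup Y w))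
        covered w with E a w in Eaw
        ... | false = z≤n
        ... | true  = ≤-reflexive (sym (cong₂ (λ x y → 𝟙 (not x ∧ y)) Xa (cov w (∈-allFin w) Eaw)))
      cut⁺ : cut E X⁺ Y + out ≤ cut E X Y
      cut⁺ = ≤-trans (≤-reflexive (trans
        (cong (cut E X⁺ Y +_) (sym (sum-single a (λ v → sum (λ w → 𝟙 (E v w))))))
        (sym (∑-distrib-+ (λ v → sum (λ w → 𝟙 (E v w ∧ (not (lookup X⁺ v) ∧ lookup Y w)))) _))))
        (sum-mono row⁺)

    -- Delete arcs for as long as the cut condition survives. The condition itself secures the
    -- in-degrees, and minimality bounds the out-degrees.
    subrelation : ∀ E → Feasible E → ∃ λ (T : Rel n) →
      (∀ v w → T v w ≡ true → E v w ≡ true) ×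
      (∀ v → sum (λ w → 𝟙 (T v w)) ≤ A v) ×
      (∀ w → B w ≤ sum (λ v → 𝟙 (T v w)))
    subrelation E₀ = go (suc (size E₀)) E₀ ≤-refl
      where
      go : ∀ k E → size E < k → Feasible E → ∃ λ (T : Rel n) →
        (∀ v w → T v w ≡ true → E v w ≡ true) ×
        (∀ v → sum (λ w → 𝟙 (T v w)) ≤ A v) ×
        (∀ w → B w ≤ sum (λ v → 𝟙 (T v w)))
      go (suc k) E lt feas
        with any? (λ a → any? (λ b → (E a b Boolₚ.≟ true) ×-dec feasible-dec (delete a b E)))
      ... | yes (a , b , Eab , feas′) with go k (delete a b E)
                                             (<-≤-trans (size-delete a b E Eab) (ℕ.s≤s⁻¹ lt)) feas′
      ...   | T , T⊆ , out , inn =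
                T , (λ v w Tvw → Boolₚ.∧-conicalˡ _ _ (T⊆ v w Tvw)) , out , inn
      go (suc k) E lt feas | no none = E , (λ _ _ → id) , minimal⇒out E feas minimal , feasible⇒in E feas
        where
        minimal : ∀ a b → E a b ≡ true → Deficient (delete a b E)
        minimal a b Eab with feasible? (delete a b E)
        ... | inj₁ f = contradiction (a , b , Eab , f) none
        ... | inj₂ d = d

    -- Weight 1/3 on every arc is a fractional solution. At least `3 * weight B Y` arcs enter `Y`;
    -- those with tail in `X` number at most `3 * weight A X`, and the others all lie in the cut.
    third⇒feasible : ∀ E → (∀ v → sum (λ w → 𝟙 (E v w)) ≤ 3 * A v) →
      (∀ w → 3 * B w ≤ sum (λ v → 𝟙 (E v w))) → Feasible E
    third⇒feasible E out≤ in≥ X Y = *-cancelˡ-≤ 3 (begin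
      3 * weight B Y
        ≡⟨ sym (sum-* 3 (λ w → if lookup Y w then B w else 0)) ⟩
      sum (λ w → 3 * (if lookup Y w then B w else 0))
        ≤⟨ sum-mono (λ w → scale (lookup Y w) (λ v → E v w) (in≥ w)) ⟩
      sum (λ w → sum (λ v → 𝟙 (E v w ∧ lookup Y w)))
        ≡⟨ ∑-comm (λ w v → 𝟙 (E v w ∧ lookup Y w)) ⟩
      sum (λ v → sum (λ w → 𝟙 (E v w ∧ lookup Y w)))
        ≤⟨ sum-mono row ⟩
      sum (λ v → 3 * (if lookup X v then A v else 0) + 3 * cutrow v)
        ≡⟨ ∑-distrib-+ (λ v → 3 * (if lookup X v then A v else 0)) _ ⟩
      sum (λ v → 3 * (if lookup X v then A v else 0)) + sum (λ v → 3 * cutrow v)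
        ≡⟨ cong₂ _+_ (sum-* 3 (λ v → if lookup X v then A v else 0)) (sum-* 3 cutrow) ⟩
      3 * weight A X + 3 * cut E X Y
        ≡⟨ sym (*-distribˡ-+ 3 (weight A X) (cut E X Y)) ⟩
      3 * (weight A X + cut E X Y) ∎)
      where
      open ≤-Reasoning
      cutrow : Fin n → ℕ
      cutrow v = sum (λ w → 𝟙 (E v w ∧ (not (lookup X v) ∧ lookup Y w)))
      scale : ∀ y (e : Fin n → Bool) {b} → 3 * b ≤ sum (𝟙 ∘ e) →
              3 * (if y then b else 0) ≤ sum (λ v → 𝟙 (e v ∧ y))
      scale true  e le = ≤-trans le (≤-reflexive (sum-cong-≗ (λ v → cong 𝟙 (sym (Boolₚ.∧-identityʳ (e v))))))
      scale false e le = z≤n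
      row : ∀ v → sum (λ w → 𝟙 (E v w ∧ lookup Y w)) ≤
                  3 * (if lookup X v then A v else 0) + 3 * cutrow v
      row v with lookup X v
      ... | true  = ≤-trans (≤-trans (sum-mono (λ w → 𝟙-∧ˡ (E v w) (lookup Y w))) (out≤ v)) (m≤m+n _ _)
      ... | false = m≤m+n _ _

-- The removal order

count≡sum : ∀ {n} (p : Fin n → Bool) → count p ≡ sum (𝟙 ∘ p)
count≡sum {zero}  p = refl
count≡sum {suc n} p = cong (ℕ._+_ (𝟙 (p zero))) (count≡sum (p ∘ suc))

count-cong : ∀ {n} {p q : Fin n → Bool} → p ≗ q → count p ≡ count q
count-cong {p = p} {q} p≗q =
  trans (count≡sum p) (trans (sum-cong-≗ (cong 𝟙 ∘ p≗q)) (sym (count≡sum q)))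

count-permute : ∀ {n} (p : Fin n → Bool) (π : Permutation n n) → count p ≡ count (λ i → p (π ⟨$⟩ʳ i))
count-permute p π = trans (count≡sum p) (trans (sum-permute (𝟙 ∘ p) π) (sym (count≡sum (λ i → p (π ⟨$⟩ʳ i)))))

count-split : ∀ {n} (p q r : Fin n → Bool) → (∀ i → 𝟙 (p i) ≡ 𝟙 (q i) ℕ.+ 𝟙 (r i)) →
              count p ≡ count q ℕ.+ count r
count-split p q r eq = trans (count≡sum p) (trans (sum-cong-≗ eq)
  (trans (∑-distrib-+ (𝟙 ∘ q) (𝟙 ∘ r)) (sym (cong₂ ℕ._+_ (count≡sum q) (count≡sum r)))))

-- In-degrees and out-degrees have the same total, so the in-degree cannot be larger at every
-- vertex.
in≤out : ∀ {n} (arc : Rel (suc n)) → ∃ λ w → count (λ v → arc v w) ℕ.≤ count (arc w)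
in≤out {n} arc with any? (λ w → count (λ v → arc v w) ℕₚ.≤? count (arc w))
... | yes found = found
... | no none = contradiction total (ℕₚ.<⇒≢ (sum-mono-< (ℕₚ.<⇒≤ ∘ lt′) zero (lt′ zero)))
  where
  lt′ : ∀ w → count (arc w) ℕ.< count (λ v → arc v w)
  lt′ w = ℕₚ.≰⇒> λ le → none (w , le)
  total : sum (λ w → count (arc w)) ≡ sum (λ w → count (λ v → arc v w))
  total = trans (sum-cong-≗ (λ w → count≡sum (arc w)))
         (trans (∑-comm (λ v w → 𝟙 (arc v w)))
                (sum-cong-≗ (λ w → sym (count≡sum (λ v → arc v w)))))

count-punchIn : ∀ {n} (p : Fin (suc n) → Bool) w (π : Permutation n n) →
  count p ≡ 𝟙 (p w) ℕ.+ count (λ j → p (insert zero w π ⟨$⟩ʳ suc j))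
count-punchIn p w π = trans (count≡sum p) (trans (sum-remove {i = w} (𝟙 ∘ p))
  (cong (ℕ._+_ (𝟙 (p w))) (trans (sym (count≡sum (p ∘ punchIn w)))
    (trans (count-permute (p ∘ punchIn w) π)
           (count-cong (λ j → cong p (sym (insert-punchIn zero w π j))))))))

-- The removal order takes the form of a renaming because the elimination always peels off vertex
-- zero.
order : ∀ {n} (arc : Rel n) → ∃ λ (π : Permutation n n) → ∀ i →
  count (λ j → lt i j ∧ arc (π ⟨$⟩ʳ j) (π ⟨$⟩ʳ i)) ℕ.≤ count (λ j → lt i j ∧ arc (π ⟨$⟩ʳ i) (π ⟨$⟩ʳ j))
order {zero}  arc = Perm.id , λ ()
order {suc n} arc with in≤out arc
... | w , le with order (λ i j → arc (punchIn w i) (punchIn w j))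
... | π , ih = insert zero w π , λ
  -- A loop at `w` would count once on either side, so its term cancels.
  { zero → ℕₚ.+-cancelˡ-≤ (𝟙 (arc w w)) _ _
      (subst₂ ℕ._≤_ (count-punchIn (λ v → arc v w) w π) (count-punchIn (arc w) w π) le)
  ; (suc i) → subst₂ ℕ._≤_
      (count-cong (λ j → cong (lt i j ∧_) (sym (cong₂ arc (insert-punchIn zero w π j) (insert-punchIn zero w π i)))))
      (count-cong (λ j → cong (lt i j ∧_) (sym (cong₂ arc (insert-punchIn zero w π i) (insert-punchIn zero w π j)))))
      (ih i) }

data Compare {n} (i j : Fin n) : Set where
  less    : lt i j ≡ true  → lt j i ≡ false → Compare i j
  equal   : lt i j ≡ false → lt j i ≡ false → i ≡ j → Compare i j
  greater : lt i j ≡ false → lt j i ≡ true  → Compare i j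

compare : ∀ {n} (i j : Fin n) → Compare i j
compare zero    zero    = equal refl refl refl
compare zero    (suc j) = less refl refl
compare (suc i) zero    = greater refl refl
compare (suc i) (suc j) with compare i j
... | less    p q      = less p q
... | equal   p q refl = equal p q refl
... | greater p q      = greater p q

does-sym : ∀ {n} (i j : Fin n) → does (i ≟ j) ≡ does (j ≟ i)
does-sym i j with i ≟ j | j ≟ i
... | yes _    | yes _    = refl
... | no _     | no _     = refl
... | yes refl | no j≢i   = contradiction refl j≢i
... | no i≢j   | yes refl = contradiction refl i≢j

-- Rounding the thirds and counting the exponents

module _ where
  open import Data.Nat.Base using (_+_; _*_; _≤_; _<_; _∸_; z≤n; s≤s)
  open ℕₚ hiding (_≟_)

  -- Here `q + φ` is `i / 3` rounded to the nearest integer; residue 2 rounds up, and the loop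
  -- supplies the one arc that is then missing.
  residues : ∀ i r q → i ≡ r + q * 3 → r < 3 → let φ = 𝟙 (r ℕ.≡ᵇ 2) in
    (φ ≡ 1 × i + 1 ≡ 3 * (q + φ)) ⊎ (φ ≡ 0 × 3 * (q + φ) ≤ i × i ≤ 3 * (q + φ) + 1)
  residues _ 0 q refl _ = inj₂ (refl , ≤-reflexive (lemma q) , ≤-trans (≤-reflexive (sym (lemma q))) (m≤m+n _ 1))
    where
    lemma : ∀ q → 3 * (q + 0) ≡ q * 3
    lemma = ℕ-Ring.solve-∀
  residues _ 1 q refl _ = inj₂ (refl , ≤-trans (m≤m+n _ 1) (≤-reflexive (lemma q)) , ≤-reflexive (sym (lemma q)))
    where
    lemma : ∀ q → 3 * (q + 0) + 1 ≡ 1 + q * 3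
    lemma = ℕ-Ring.solve-∀
  residues _ 2 q refl _ = inj₁ (refl , lemma q)
    where
    lemma : ∀ q → 2 + q * 3 + 1 ≡ 3 * (q + 1)
    lemma = ℕ-Ring.solve-∀
  residues _ (suc (suc (suc _))) _ _ (s≤s (s≤s (s≤s ())))

  -- The loop at v (present iff the in-degree is 2 mod 3) links the two roundings at v: it forbids
  -- rounding T's in-degree down while rounding its out-degree up.
  module Thirds {n} (H : Rel n) (irr : ∀ v → H v v ≡ false) where
    -- In thirds, an arc of `T` is worth 6 to its head and costs its tail 3. Exact thirds would
    -- balance `2 * ib` against `6 * τ` and `3 * t` against `of`; the 4 is the joint rounding error.
    Thinning : Set
    Thinning = ∃ λ (T : Rel n) →
      (∀ v w → T v w ≡ true → H v w ≡ true) ×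
      (∀ v → 2 * count (λ u → H u v) + 3 * count (T v) ≤ 6 * count (λ u → T u v) + count (H v) + 4)

    ib of φ A B : Fin n → ℕ
    ib v = count (λ u → H u v)
    of v = count (H v)
    flag : Fin n → Bool
    flag v = ib v % 3 ℕ.≡ᵇ 2
    φ v = 𝟙 (flag v)
    -- The `+ 2` makes this a ceiling; the out-degree includes the loop.
    A v = (of v + φ v + 2) / 3
    B v = ib v / 3 + φ v
    E : Rel n
    E v w = H v w ∨ (does (v ≟ w) ∧ flag v)
    E≡ : ∀ v w → 𝟙 (E v w) ≡ 𝟙 (H v w) + (if does (v ≟ w) then φ v else 0)
    E≡ v w with v ≟ w
    ... | yes refl rewrite irr v = refl
    ... | no _     = trans (cong 𝟙 (Boolₚ.∨-identityʳ (H v w))) (sym (+-identityʳ _))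
    outE : ∀ v → sum (λ w → 𝟙 (E v w)) ≡ of v + φ v
    outE v = trans (sum-cong-≗ (E≡ v)) (trans (∑-distrib-+ (λ w → 𝟙 (H v w)) _)
      (cong₂ _+_ (sym (count≡sum (H v))) (sum-single v (λ _ → φ v))))
    inE : ∀ w → sum (λ v → 𝟙 (E v w)) ≡ ib w + φ w
    inE w = trans (sum-cong-≗ (λ v → E≡ v w)) (trans (∑-distrib-+ (λ v → 𝟙 (H v w)) _)
      (cong₂ _+_ (sym (count≡sum (λ v → H v w)))
        (trans (sum-cong-≗ (λ v → cong (if_then φ v else 0) (does-sym v w))) (sum-single w φ))))
    3A≡ : ∀ v → of v + φ v + 2 ≡ (of v + φ v + 2) % 3 + A v * 3
    3A≡ v = m≡m%n+[m/n]*n (of v + φ v + 2) 3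
    out≤ : ∀ v → sum (λ w → 𝟙 (E v w)) ≤ 3 * A v
    out≤ v = ≤-trans (≤-reflexive (outE v)) (+-cancelˡ-≤ 2 _ _ (begin
      2 + (of v + φ v)                    ≡⟨ +-comm 2 _ ⟩
      of v + φ v + 2                      ≡⟨ 3A≡ v ⟩
      (of v + φ v + 2) % 3 + A v * 3      ≤⟨ +-mono-≤ (ℕ.s≤s⁻¹ (m%n<n (of v + φ v + 2) 3)) (≤-reflexive (*-comm (A v) 3)) ⟩
      2 + 3 * A v                         ∎))
      where open ≤-Reasoning
    3A≤ : ∀ v → 3 * A v ≤ of v + φ v + 2
    3A≤ v = ≤-trans (≤-reflexive (*-comm 3 (A v)))
      (≤-trans (m≤n+m (A v * 3) _) (≤-reflexive (sym (3A≡ v))))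
    bounds : ∀ v → (φ v ≡ 1 × ib v + 1 ≡ 3 * B v) ⊎ (φ v ≡ 0 × 3 * B v ≤ ib v × ib v ≤ 3 * B v + 1)
    bounds v = residues (ib v) (ib v % 3) (ib v / 3) (m≡m%n+[m/n]*n (ib v) 3) (m%n<n (ib v) 3)
    in≥ : ∀ w → 3 * B w ≤ sum (λ v → 𝟙 (E v w))
    in≥ w with bounds w
    ... | inj₁ (φ≡1 , eq) = ≤-reflexive (trans (sym eq) (trans (cong (ib w +_) (sym φ≡1)) (sym (inE w))))
    ... | inj₂ (_ , le , _) = ≤-trans le (≤-trans (m≤m+n (ib w) (φ w)) (≤-reflexive (sym (inE w))))
    feasible : Feasible A B E
    feasible = third⇒feasible A B E out≤ in≥

    module _ (T′ : Rel n) (T′⊆ : ∀ v w → T′ v w ≡ true → E v w ≡ true)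
      (out : ∀ v → sum (λ w → 𝟙 (T′ v w)) ≤ A v)
      (inn : ∀ w → B w ≤ sum (λ v → 𝟙 (T′ v w))) where

      T : Rel n
      T v w = H v w ∧ T′ v w
      T⊆ : ∀ v w → T v w ≡ true → H v w ≡ true
      T⊆ v w = Boolₚ.∧-conicalˡ _ _
      ℓ : Fin n → ℕ
      ℓ v = 𝟙 (T′ v v)
      T′≡ : ∀ v w → 𝟙 (T′ v w) ≡ 𝟙 (T v w) + (if does (v ≟ w) then 𝟙 (T′ v v) else 0)
      T′≡ v w with T′ v w in eq | v ≟ w
      ... | b     | yes refl = cong₂ (λ h c → 𝟙 (h ∧ b) + 𝟙 c) (sym (irr v)) (sym eq)
      ... | false | no _     = sym (trans (+-identityʳ _) (cong 𝟙 (Boolₚ.∧-zeroʳ (H v w))))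
      ... | true  | no v≢w with H v w | v ≟ w | T′⊆ v w eq
      ...   | true  | _       | _ = refl
      ...   | false | yes v≡w | _ = contradiction v≡w v≢w
      t τ : Fin n → ℕ
      t v = count (T v)
      τ v = count (λ u → T u v)
      out′ : ∀ v → t v + ℓ v ≤ A v
      out′ v = ≤-trans (≤-reflexive (sym (trans (sum-cong-≗ (T′≡ v))
        (trans (∑-distrib-+ (λ w → 𝟙 (T v w)) _)
               (cong₂ _+_ (sym (count≡sum (T v))) (sum-single v (λ _ → ℓ v))))))) (out v)
      in′ : ∀ w → B w ≤ τ w + ℓ w
      in′ w = ≤-trans (inn w) (≤-reflexive (trans (sum-cong-≗ (λ v → T′≡ v w))
        (trans (∑-distrib-+ (λ v → 𝟙 (T v w)) _)
               (cong₂ _+_ (sym (count≡sum (λ v → T v w)))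
                 (trans (sum-cong-≗ (λ v → cong (if_then ℓ v else 0) (does-sym v w))) (sum-single w ℓ))))))
      ℓ≤φ : ∀ v → ℓ v ≤ φ v
      ℓ≤φ v with T′ v v in eq
      ... | false = z≤n
      ... | true with H v v | irr v | v ≟ v | T′⊆ v v eq
      ...   | _ | refl | yes _ | flagged = ≤-reflexive (cong 𝟙 (sym flagged))
      -- Without the flag the head loses at most 2 and the tail at most 2. With it, a loop taken by
      -- `T′` lets the head lose 4, but it uses up one unit of `A v` and the tail loses nothing; a
      -- loop left out makes the head gain 2 while the tail loses at most 3.
      bound : ∀ v → 2 * ib v + 3 * t v ≤ 6 * τ v + of v + 4
      -- The added `3 * ℓ v` completes `3 * t v` to the quantity bounded by `A`, and the 2 completes
      -- `2 * ib v` to `2 * (ib v + 1)` in the flagged case.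
      bound v = +-cancelʳ-≤ (3 * ℓ v + 2) _ _ (go (bounds v))
        where
        open ≤-Reasoning
        3t≤ : 3 * t v + 3 * ℓ v ≤ of v + φ v + 2
        3t≤ = ≤-trans (≤-reflexive (sym (*-distribˡ-+ 3 (t v) (ℓ v)))) (≤-trans (*-monoʳ-≤ 3 (out′ v)) (3A≤ v))
        3B≤ : 3 * B v ≤ 3 * τ v + 3 * ℓ v
        3B≤ = ≤-trans (*-monoʳ-≤ 3 (in′ v)) (≤-reflexive (*-distribˡ-+ 3 (τ v) (ℓ v)))
        go : _ → 2 * ib v + 3 * t v + (3 * ℓ v + 2) ≤ 6 * τ v + of v + 4 + (3 * ℓ v + 2)
        go (inj₁ (φ≡1 , ib+1≡)) = begin
          2 * ib v + 3 * t v + (3 * ℓ v + 2)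
            ≡⟨ lemma₁ (ib v) (t v) (ℓ v) ⟩
          2 * (ib v + 1) + (3 * t v + 3 * ℓ v)
            ≤⟨ +-mono-≤ (*-monoʳ-≤ 2 (≤-trans (≤-reflexive ib+1≡) 3B≤)) 3t≤ ⟩
          2 * (3 * τ v + 3 * ℓ v) + (of v + φ v + 2)
            ≡⟨ cong (λ f → 2 * (3 * τ v + 3 * ℓ v) + (of v + f + 2)) φ≡1 ⟩
          2 * (3 * τ v + 3 * ℓ v) + (of v + 1 + 2)
            ≡⟨ lemma₂ (τ v) (ℓ v) (of v) ⟩
          6 * τ v + of v + 3 + 3 * ℓ v + 3 * ℓ v
            ≤⟨ +-monoʳ-≤ (6 * τ v + of v + 3 + 3 * ℓ v) (*-monoʳ-≤ 3 (≤-trans (ℓ≤φ v) (≤-reflexive φ≡1))) ⟩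
          6 * τ v + of v + 3 + 3 * ℓ v + 3
            ≡⟨ lemma₃ (τ v) (of v) (ℓ v) ⟩
          6 * τ v + of v + 4 + (3 * ℓ v + 2) ∎
          where
          lemma₁ : ∀ i t l → 2 * i + 3 * t + (3 * l + 2) ≡ 2 * (i + 1) + (3 * t + 3 * l)
          lemma₁ = ℕ-Ring.solve-∀
          lemma₂ : ∀ a l o → 2 * (3 * a + 3 * l) + (o + 1 + 2) ≡ 6 * a + o + 3 + 3 * l + 3 * l
          lemma₂ = ℕ-Ring.solve-∀
          lemma₃ : ∀ a o l → 6 * a + o + 3 + 3 * l + 3 ≡ 6 * a + o + 4 + (3 * l + 2)
          lemma₃ = ℕ-Ring.solve-∀
        go (inj₂ (φ≡0 , _ , ib≤)) = begin
          2 * ib v + 3 * t v + (3 * ℓ v + 2)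
            ≡⟨ lemma₁ (ib v) (t v) (ℓ v) ⟩
          2 * ib v + (3 * t v + 3 * ℓ v) + 2
            ≤⟨ +-monoˡ-≤ 2 (+-mono-≤ (*-monoʳ-≤ 2 (≤-trans ib≤ (+-monoˡ-≤ 1 3B≤))) 3t≤) ⟩
          2 * (3 * τ v + 3 * ℓ v + 1) + (of v + φ v + 2) + 2
            ≡⟨ cong₂ (λ l f → 2 * (3 * τ v + 3 * l + 1) + (of v + f + 2) + 2) ℓ≡0 φ≡0 ⟩
          2 * (3 * τ v + 0 + 1) + (of v + 0 + 2) + 2
            ≡⟨ lemma₂ (τ v) (of v) ⟩
          6 * τ v + of v + 4 + 2
            ≤⟨ +-monoʳ-≤ (6 * τ v + of v + 4) (m≤n+m 2 (3 * ℓ v)) ⟩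
          6 * τ v + of v + 4 + (3 * ℓ v + 2) ∎
          where
          ℓ≡0 : ℓ v ≡ 0
          ℓ≡0 = n≤0⇒n≡0 (≤-trans (ℓ≤φ v) (≤-reflexive φ≡0))
          lemma₁ : ∀ i t l → 2 * i + 3 * t + (3 * l + 2) ≡ 2 * i + (3 * t + 3 * l) + 2
          lemma₁ = ℕ-Ring.solve-∀
          lemma₂ : ∀ a o → 2 * (3 * a + 0 + 1) + (o + 0 + 2) + 2 ≡ 6 * a + o + 4 + 2
          lemma₂ = ℕ-Ring.solve-∀

      unloop : Thinning
      unloop = T , T⊆ , bound

    thinning : Thinning
    thinning = let T′ , T′⊆ , out , inn = subrelation A B E feasible in unloop T′ T′⊆ out inn

  -- Adding the two inequalities leaves an error of 4 - 3 = 1 third, which integrality absorbs. The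
  -- surplus `e` of out-arcs over in-arcs is kept whole, although only 2/3 of it is needed.
  degree-bound : ∀ f ib e g t τ → 2 * ib + 3 * t ≤ 6 * τ + (g + t) + 4 →
    3 * f + 3 ≤ 2 * ((ib + e) + (g + t)) → f ≤ e + 2 * τ + g
  degree-bound f ib e g t τ le₁ le₂ = ℕ.s≤s⁻¹ (*-cancelˡ-< 3 _ _ (begin-strict
    3 * f                     ≤⟨ +-cancelʳ-≤ (3 + (2 * ib + 3 * t)) _ _ (begin
      3 * f + (3 + (2 * ib + 3 * t))                            ≡⟨ sym (+-assoc (3 * f) 3 _) ⟩
      3 * f + 3 + (2 * ib + 3 * t)                              ≤⟨ +-mono-≤ le₂ le₁ ⟩
      2 * ((ib + e) + (g + t)) + (6 * τ + (g + t) + 4)          ≡⟨ lemma₁ ib e g t τ ⟩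
      2 * e + 6 * τ + 3 * g + 1 + (3 + (2 * ib + 3 * t))        ∎) ⟩
    2 * e + 6 * τ + 3 * g + 1          ≤⟨ m≤m+n _ e ⟩
    2 * e + 6 * τ + 3 * g + 1 + e      <⟨ m<m+n _ {2} (s≤s z≤n) ⟩
    2 * e + 6 * τ + 3 * g + 1 + e + 2  ≡⟨ lemma₂ e τ g ⟩
    3 * suc (e + 2 * τ + g)            ∎))
    where
    open ≤-Reasoning
    lemma₁ : ∀ i e g t a → 2 * ((i + e) + (g + t)) + (6 * a + (g + t) + 4) ≡
                           2 * e + 6 * a + 3 * g + 1 + (3 + (2 * i + 3 * t))
    lemma₁ = ℕ-Ring.solve-∀
    lemma₂ : ∀ e a g → 2 * e + 6 * a + 3 * g + 1 + e + 2 ≡ 3 * (1 + (e + 2 * a + g))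
    lemma₂ = ℕ-Ring.solve-∀

  -- An arc into i from a larger j is kept (rs) when i pays for it, and dropped when it lies in T.
  module Ordered {n} (adj arc : Rel n) (F : Fin n → List ℕ)
    (adj≡ : ∀ i j → 𝟙 (adj i j) ≡ 𝟙 (arc i j) + 𝟙 (arc j i))
    (arc-irr : ∀ i → arc i i ≡ false)
    (ib≤ob : ∀ i → count (λ j → lt i j ∧ arc j i) ≤ count (λ j → lt i j ∧ arc i j))
    (bounded : ∀ i → 3 * length (F i) + 3 ≤ 2 * count (arc i)) where

    H : Rel n
    H v w = lt w v ∧ arc v w

    H-irr : ∀ v → H v v ≡ false
    H-irr v = trans (cong (lt v v ∧_) (arc-irr v)) (Boolₚ.∧-zeroʳ _)

    module _ (T : Rel n) (T⊆ : ∀ v w → T v w ≡ true → H v w ≡ true)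
      (bound : ∀ v → 2 * count (λ u → H u v) + 3 * count (T v) ≤
                     6 * count (λ u → T u v) + count (H v) + 4) where

      rs : Rel n
      rs i j = arc j i ∧ not (T j i)
      ib ob of t τ own g : Fin n → ℕ
      ib i = count (λ j → lt i j ∧ arc j i)
      ob i = count (λ j → lt i j ∧ arc i j)
      of i = count (λ j → lt j i ∧ arc i j)
      t i = count (T i)
      τ i = count (λ j → T j i)
      -- This is `N - 2k` for `N = ob i + ib i` remaining neighbours and `k = ib i - τ i` served
      -- ones; the truncated subtraction is exact by `ib≤ob`.
      own i = ob i ∸ ib i + 2 * τ i
      g j = count (λ i → lt i j ∧ rs i j)
      rs⇒adj : ∀ i j → rs i j ≡ true → adj i j ≡ true
      rs⇒adj i j eq with adj i j | arc i j | arc j i | adj≡ i j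
      ... | true | _ | _ | _ = refl
      ... | false | false | true | ()
      ... | false | true | true | ()
      split : ∀ i j → 𝟙 (lt i j ∧ arc j i) ≡ 𝟙 (lt i j ∧ rs i j) + 𝟙 (T j i)
      split i j with T j i in eq
      ... | false = trans (cong (λ b → 𝟙 (lt i j ∧ b)) (sym (Boolₚ.∧-identityʳ (arc j i)))) (sym (+-identityʳ _))
      ... | true = trans (cong 𝟙 (T⊆ j i eq)) (cong (λ b → 𝟙 b + 1) (sym
                     (trans (cong (lt i j ∧_) (Boolₚ.∧-zeroʳ (arc j i))) (Boolₚ.∧-zeroʳ (lt i j)))))
      ib≡ : ∀ i → ib i ≡ count (λ j → lt i j ∧ rs i j) + τ i
      ib≡ i = count-split _ _ _ (split i)
      of≡ : ∀ j → of j ≡ g j + t j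
      of≡ j = count-split _ _ _ (λ i → split i j)
      own-eq : ∀ i → own i + 2 * count (λ j → lt i j ∧ rs i j) ≡ count (λ j → lt i j ∧ adj i j)
      own-eq i = begin
        ob i ∸ ib i + 2 * τ i + 2 * ρ     ≡⟨ lemma (ob i ∸ ib i) (τ i) ρ ⟩
        ob i ∸ ib i + 2 * (ρ + τ i)       ≡⟨ cong (λ x → ob i ∸ ib i + 2 * x) (sym (ib≡ i)) ⟩
        ob i ∸ ib i + 2 * ib i            ≡⟨ lemma′ (ob i ∸ ib i) (ib i) ⟩
        ob i ∸ ib i + ib i + ib i         ≡⟨ cong (_+ ib i) (m∸n+n≡m (ib≤ob i)) ⟩
        ob i + ib i                       ≡⟨ sym (count-split _ _ _ pointwise) ⟩
        count (λ j → lt i j ∧ adj i j)    ∎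
        where
        open ≡-Reasoning
        ρ = count (λ j → lt i j ∧ rs i j)
        lemma : ∀ d a r → d + 2 * a + 2 * r ≡ d + 2 * (r + a)
        lemma = ℕ-Ring.solve-∀
        lemma′ : ∀ d b → d + 2 * b ≡ d + b + b
        lemma′ = ℕ-Ring.solve-∀
        pointwise : ∀ j → 𝟙 (lt i j ∧ adj i j) ≡ 𝟙 (lt i j ∧ arc i j) + 𝟙 (lt i j ∧ arc j i)
        pointwise j with lt i j
        ... | true  = adj≡ i j
        ... | false = refl
      out≡ : ∀ i → count (arc i) ≡ ob i + of i
      out≡ i = count-split _ _ _ pointwise
        where
        pointwise : ∀ j → 𝟙 (arc i j) ≡ 𝟙 (lt i j ∧ arc i j) + 𝟙 (lt j i ∧ arc i j)
        pointwise j with compare i j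
        ... | less    p q      rewrite p | q = sym (+-identityʳ _)
        ... | equal   p q refl rewrite p = cong 𝟙 (arc-irr i)
        ... | greater p q      rewrite p | q = refl
      enough : ∀ i → length (F i) ≤ own i + g i
      enough i = degree-bound (length (F i)) (ib i) (ob i ∸ ib i) (g i) (t i) (τ i)
        (subst (λ o → 2 * ib i + 3 * t i ≤ 6 * τ i + o + 4) (of≡ i) (bound i))
        (≤-trans (bounded i) (≤-reflexive (cong (2 *_)
          (trans (out≡ i) (cong₂ _+_ (sym (m+[n∸m]≡n (ib≤ob i))) (of≡ i))))))

      avoid : ∃ λ s → ∀ v → count (toArc adj s v) ∉ F v
      avoid = let S , S⊆ , c≢0 = coef-nonzero adj rs own rs⇒adj own-eq
              in  nullstellensatz adj F (λ j → own j + g j) S S⊆ c≢0 enough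

    avoiding : ∃ λ s → ∀ v → count (toArc adj s v) ∉ F v
    avoiding = let T , T⊆ , bound = Thirds.thinning H H-irr in avoid T T⊆ bound

-- From one bit per edge back to an orientation of `G`

toArc-⊆ : ∀ {n} (adj s : Rel n) → (∀ u v → adj u v ≡ adj v u) →
          ∀ u v → toArc adj s u v ≡ true → adj u v ≡ true
toArc-⊆ adj s adj-sym u v eq with compare u v
... | less p q rewrite p = Boolₚ.∧-conicalˡ _ _ eq
... | greater p q rewrite p | q = trans (adj-sym u v) (Boolₚ.∧-conicalˡ _ _ eq)
... | equal p q _ rewrite p | q with () ← eq

toArc-one-dir : ∀ {n} (adj s : Rel n) → (∀ u v → adj u v ≡ adj v u) → (∀ v → adj v v ≡ false) →
                ∀ u v → adj u v ≡ true → toArc adj s u v ≢ toArc adj s v u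
toArc-one-dir adj s adj-sym adj-irr u v uv with compare u v
... | less p q rewrite p | q | uv = Boolₚ.not-¬ refl
... | greater p q rewrite p | q | trans (adj-sym v u) uv = Boolₚ.not-¬ refl ∘ sym
... | equal p q refl with () ← trans (sym uv) (adj-irr u)

module Relabel {n} (G : Graph n) (F : FSets n) (D : Orientation G) (bounded : Bounded F D)
  (π : Permutation n n)
  (ib≤ob : ∀ i → count (λ j → lt i j ∧ arc D (π ⟨$⟩ʳ j) (π ⟨$⟩ʳ i)) ℕ.≤
                 count (λ j → lt i j ∧ arc D (π ⟨$⟩ʳ i) (π ⟨$⟩ʳ j))) where

  adj′ arc′ : Rel n
  adj′ i j = adj G (π ⟨$⟩ʳ i) (π ⟨$⟩ʳ j)
  arc′ i j = arc D (π ⟨$⟩ʳ i) (π ⟨$⟩ʳ j)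

  loopless : ∀ v → arc D v v ≡ false
  loopless v with arc D v v in eq
  ... | false = refl
  ... | true with () ← trans (sym (arc⊆adj D v v eq)) (adj-irr G v)

  exactly-one : ∀ u v → 𝟙 (adj G u v) ≡ 𝟙 (arc D u v) ℕ.+ 𝟙 (arc D v u)
  exactly-one u v with adj G u v in uv | arc D u v in a | arc D v u in b
  ... | true  | true  | false = refl
  ... | true  | false | true  = refl
  ... | false | false | false = refl
  ... | true  | true  | true  = contradiction (trans a (sym b)) (one-dir D u v uv)
  ... | true  | false | false = contradiction (trans a (sym b)) (one-dir D u v uv)
  ... | false | true  | _ with () ← trans (sym uv) (arc⊆adj D u v a)
  exactly-one u v | false | false | true
    with () ← trans (sym uv) (trans (adj-sym G u v) (arc⊆adj D v u b))

  bounded′ : ∀ i → 3 ℕ.* length (F (π ⟨$⟩ʳ i)) ℕ.+ 3 ℕ.≤ 2 ℕ.* count (arc′ i)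
  bounded′ i = subst (λ d → 3 ℕ.* length (F (π ⟨$⟩ʳ i)) ℕ.+ 3 ℕ.≤ 2 ℕ.* d)
    (count-permute (arc D (π ⟨$⟩ʳ i)) π) (bounded (π ⟨$⟩ʳ i))

  adj′-sym : ∀ i j → adj′ i j ≡ adj′ j i
  adj′-sym i j = adj-sym G _ _

  adj′≡ : ∀ u v → adj′ (π ⟨$⟩ˡ u) (π ⟨$⟩ˡ v) ≡ adj G u v
  adj′≡ u v = cong₂ (adj G) (inverseʳ π) (inverseʳ π)

  restore : (∃ λ s → ∀ i → count (toArc adj′ s i) ∉ F (π ⟨$⟩ʳ i)) →
            ∃ λ (D′ : Orientation G) → Avoiding F D′
  restore (s , avoids) = record
    { arc     = λ u v → toArc adj′ s (π ⟨$⟩ˡ u) (π ⟨$⟩ˡ v)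
    ; arc⊆adj = λ u v eq → trans (sym (adj′≡ u v)) (toArc-⊆ adj′ s adj′-sym _ _ eq)
    ; one-dir = λ u v uv → toArc-one-dir adj′ s adj′-sym (λ _ → adj-irr G _) _ _ (trans (adj′≡ u v) uv)
    } , λ v out∈ → avoids (π ⟨$⟩ˡ v) (subst₂ _∈_
          (sym (count-permute (toArc adj′ s (π ⟨$⟩ˡ v)) (flip π)))
          (cong F (sym (inverseʳ π))) out∈)

  avoiding : ∃ λ (D′ : Orientation G) → Avoiding F D′
  avoiding = restore (Ordered.avoiding adj′ arc′ (λ i → F (π ⟨$⟩ʳ i))
    (λ i j → exactly-one (π ⟨$⟩ʳ i) (π ⟨$⟩ʳ j)) (λ i → loopless (π ⟨$⟩ʳ i)) ib≤ob bounded′)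

theorem4 : (n : ℕ) (G : Graph n) (F : FSets n) → WellFormedF F →
    (∃ λ (D : Orientation G) → Bounded F D) →
    ∃ λ (D′ : Orientation G) → Avoiding F D′
theorem4 n G F _ (D , bounded) =
  let π , ib≤ob = order (arc D) in Relabel.avoiding G F D bounded π ib≤ob
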